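{- For $n\ge 3$ let $C_n$ be the cycle graph with $n$ vertices, and let $\mathbb{Z}$ denote the one-dimensional integer lattice (the infinite 2-regular path graph on vertex set $\mathbb{Z}$ with edges $\{k,k+1\}$). Then for every complex $u$ with $|u|<1$, \[ \lim_{n\to\infty}\zeta_{C_n}(u)=\zeta_{\mathbb{Z}}(u). \]
   Context: For a vertex transitive $(q+1)$-regular graph $G$ and a fixed vertex $x_0$, the generalized Ihara zeta function is $\zeta_G(u)=\exp\big(\sum_{m\ge1}\frac{N^0_m}{m}u^m\big)$, where $N^0_m$ is the number of reduced $x_0$-cycles of length $m$ in $G$. Here a path of length $m$ is a sequence $(e_1,\ldots,e_m)$ of oriented edges (arcs) with the terminus of $e_i$ equal to the origin of $e_{i+1}$; it has a backtracking if $e_{i+1}=e_i^{ -1}$ for some $i$ (where $e^{ -1}$ is the reversed arc); an $x_0$-cycle is a path starting and ending at $x_0$; it has a tail if $e_m=e_1^{ -1}$; it is reduced if it has neither a backtracking nor a tail. -}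

module Defs where

open import Data.Empty using (⊥-elim)
open import Data.Fin as Fin using (Fin; toℕ)
open import Data.Integer as ℤ using (ℤ; +_; -[1+_])
import Data.Integer.Properties as ℤP
open import Data.List using (length)
open import Data.List.Membership.Propositional using (_∈_)
open import Data.List.Relation.Unary.Unique.Propositional using (Unique)
open import Data.Nat as ℕ using (ℕ; zero; suc; _!)
import Data.Nat.Properties as ℕP
import Data.Nat.Solver as ℕSolver
open import Data.Product using (∃; ∃-syntax; ∃₂; _×_; _,_)
open import Data.Rational as ℚ using (ℚ; mkℚ; 0ℚ; 1ℚ; ½; _/_; ↥_; ↧ₙ_)
import Data.Rational.Properties as ℚP
import Data.Rational.Solver as ℚSolver
import Data.Rational.Unnormalised as ℚᵘ
import Data.Rational.Unnormalised.Properties as ℚᵘP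
open import Data.Sum using (_⊎_; inj₁; inj₂; swap)
open import Data.Vec using (Vec; head; last)
open import Data.Vec.Relation.Unary.Linked using (Linked)
open import Function using (_⇔_)
open import Relation.Binary.PropositionalEquality
  using (_≡_; _≢_; refl; sym; trans; cong; cong₂; subst; subst₂)
open import Relation.Nullary using (¬_; yes; no)

half-pos : ∀ {ε} → 0ℚ ℚ.< ε → 0ℚ ℚ.< ½ ℚ.* ε
half-pos {ε} 0<ε = subst (ℚ._< ½ ℚ.* ε) (ℚP.*-zeroʳ ½) (ℚP.*-monoʳ-<-pos ½ 0<ε)

half+half : ∀ ε → ½ ℚ.* ε ℚ.+ ½ ℚ.* ε ≡ ε
half+half = solve 1 (λ e → con ½ :* e :+ con ½ :* e := e) refl
  where open ℚSolver.+-*-Solver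

*-mono : ∀ {a b c d} → 0ℚ ℚ.≤ a → 0ℚ ℚ.≤ c → a ℚ.≤ b → c ℚ.≤ d → a ℚ.* c ℚ.≤ b ℚ.* d
*-mono {a} {b} {c} {d} 0≤a 0≤c a≤b c≤d = ℚP.≤-trans
  (ℚP.*-monoʳ-≤-nonNeg c {{ℚ.nonNegative 0≤c}} a≤b)
  (ℚP.*-monoˡ-≤-nonNeg b {{ℚ.nonNegative (ℚP.≤-trans 0≤a a≤b)}} c≤d)

*-pos : ∀ {a b} → 0ℚ ℚ.< a → 0ℚ ℚ.< b → 0ℚ ℚ.< a ℚ.* b
*-pos {a} {b} 0<a 0<b =
  subst (ℚ._< a ℚ.* b) (ℚP.*-zeroʳ a) (ℚP.*-monoʳ-<-pos a {{ℚ.positive 0<a}} 0<b)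

p≤∣p∣ : ∀ p → p ℚ.≤ ℚ.∣ p ∣
p≤∣p∣ p with ℚP.≤-total 0ℚ p
... | inj₁ 0≤p = ℚP.≤-reflexive (sym (ℚP.0≤p⇒∣p∣≡p 0≤p))
... | inj₂ p≤0 = ℚP.≤-trans p≤0 (ℚP.0≤∣p∣ p)

∣-∣<⇒< : ∀ {p q δ} → ℚ.∣ p ℚ.- q ∣ ℚ.< δ → p ℚ.< q ℚ.+ δ
∣-∣<⇒< {p} {q} {δ} h = subst (ℚ._< q ℚ.+ δ)
  (solve 2 (λ a b → b :+ (a :- b) := a) refl p q)
  (ℚP.+-monoʳ-< q (ℚP.≤-<-trans (p≤∣p∣ (p ℚ.- q)) h))
  where open ℚSolver.+-*-Solver

<⇒∣-∣< : ∀ {p q δ} → p ℚ.< q ℚ.+ δ → q ℚ.< p ℚ.+ δ → ℚ.∣ p ℚ.- q ∣ ℚ.< δ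
<⇒∣-∣< {p} {q} {δ} p<q+δ q<p+δ with ℚP.∣p∣≡p∨∣p∣≡-p (p ℚ.- q)
... | inj₁ e = subst₂ ℚ._<_ (sym e)
  (solve 2 (λ b d → b :+ d :- b := d) refl q δ) (ℚP.+-monoˡ-< (ℚ.- q) p<q+δ)
  where open ℚSolver.+-*-Solver
... | inj₂ e = subst₂ ℚ._<_
  (trans (solve 2 (λ a b → b :- a := :- (a :- b)) refl p q) (sym e))
  (solve 2 (λ b d → b :+ d :- b := d) refl p δ) (ℚP.+-monoˡ-< (ℚ.- p) q<p+δ)
  where open ℚSolver.+-*-Solver

square-cancel-≤ : ∀ {p q} → 0ℚ ℚ.≤ q → p ℚ.* p ℚ.≤ q ℚ.* q → p ℚ.≤ q
square-cancel-≤ {p} {q} 0≤q pp≤qq with p ℚP.≤? q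
... | yes p≤q = p≤q
... | no p≰q = ⊥-elim (ℚP.<-irrefl refl (ℚP.≤-<-trans pp≤qq qq<pp))
  where
  q<p = ℚP.≰⇒> p≰q
  qq<pp : q ℚ.* q ℚ.< p ℚ.* p
  qq<pp = ℚP.≤-<-trans (ℚP.*-monoˡ-≤-nonNeg q {{ℚ.nonNegative 0≤q}} (ℚP.<⇒≤ q<p))
    (ℚP.*-monoˡ-<-pos p {{ℚ.positive (ℚP.≤-<-trans 0≤q q<p)}} q<p)

toℚᵘ-/ : ∀ i n → ℚ.toℚᵘ (i / suc n) ℚᵘ.≃ ℚᵘ.mkℚᵘ i n
toℚᵘ-/ i n = ℚP.toℚᵘ-fromℚᵘ (ℚᵘ.mkℚᵘ i n)

1/suc : ℕ → ℚ
1/suc n = + 1 / suc n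

archimedean : ∀ {ε} → 0ℚ ℚ.< ε → ∃[ N ] (∀ n → N ℕ.≤ n → 1/suc n ℚ.< ε)
archimedean {mkℚ (+ zero) d c} 0<ε = ⊥-elim (absurd (ℚP.drop-*<* 0<ε))
  where
  absurd : ¬ (+ 0 ℤ.* + suc d ℤ.< + 0 ℤ.* + 1)
  absurd (ℤ.+<+ ())
archimedean {mkℚ -[1+ a ] d c} 0<ε = ⊥-elim (absurd (ℚP.drop-*<* 0<ε))
  where
  absurd : ¬ (+ 0 ℤ.* + suc d ℤ.< -[1+ a ] ℤ.* + 1)
  absurd ()
archimedean {ε@(mkℚ (+ suc a) d c)} 0<ε = suc d , λ n d<n →
  ℚP.toℚᵘ-cancel-< (ℚᵘP.<-respˡ-≃ (ℚᵘP.≃-sym (toℚᵘ-/ (+ 1) n))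
    (ℚᵘ.*<* (subst₂ ℤ._<_ (ℤP.pos-* 1 (suc d)) (ℤP.pos-* (suc a) (suc n)) (ℤ.+<+
      (ℕP.≤-trans (ℕ.s≤s (ℕP.≤-trans (ℕP.≤-reflexive (ℕP.*-identityˡ (suc d))) d<n))
        (ℕP.m≤m+n (suc n) (a ℕ.* suc n)))))))

IsCauchy : (ℕ → ℚ) → Set
IsCauchy x = ∀ {ε} → 0ℚ ℚ.< ε →
  ∃[ N ] (∀ m n → N ℕ.≤ m → N ℕ.≤ n → ℚ.∣ x m ℚ.- x n ∣ ℚ.< ε)

-- Different sequences may represent the same real.  No quotient is taken: the
-- order below, and with it every limit, is insensitive to the representative.
record ℝ : Set where
  constructor mkℝ
  field
    seq    : ℕ → ℚ
    cauchy : IsCauchy seq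

open ℝ

infix 4 _<ᴿ_
infixl 6 _+ᴿ_ _-ᴿ_
infixl 7 _*ᴿ_
infix 8 -ᴿ_

_<ᴿ_ : ℝ → ℝ → Set
x <ᴿ y = ∃[ δ ] 0ℚ ℚ.< δ × ∃[ N ] (∀ n → N ℕ.≤ n → seq x n ℚ.+ δ ℚ.< seq y n)

fromℚ : ℚ → ℝ
fromℚ q = mkℝ (λ _ → q) λ {ε} 0<ε → 0 , λ _ _ _ _ →
  subst (λ d → ℚ.∣ d ∣ ℚ.< ε) (sym (ℚP.+-inverseʳ q)) 0<ε

0ᴿ 1ᴿ : ℝ
0ᴿ = fromℚ 0ℚ
1ᴿ = fromℚ 1ℚ

abstract
  neg-cauchy : ∀ x → IsCauchy (λ n → ℚ.- seq x n)
  neg-cauchy x {ε} 0<ε = let (N , h) = cauchy x 0<ε in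
    N , λ m n N≤m N≤n → subst (λ d → ℚ.∣ d ∣ ℚ.< ε)
      (solve 2 (λ a b → b :- a := :- a :- :- b) refl (seq x m) (seq x n)) (h n m N≤n N≤m)
    where open ℚSolver.+-*-Solver

-ᴿ_ : ℝ → ℝ
-ᴿ x = mkℝ (λ n → ℚ.- seq x n) (neg-cauchy x)

abstract
  +-cauchy : ∀ x y → IsCauchy (λ n → seq x n ℚ.+ seq y n)
  +-cauchy x y {ε} 0<ε =
    let (M , f) = cauchy x (half-pos 0<ε)
        (N , g) = cauchy y (half-pos 0<ε)
    in M ℕ.⊔ N , λ m n M⊔N≤m M⊔N≤n →
      let dx = seq x m ℚ.- seq x n
          dy = seq y m ℚ.- seq y n
      in subst₂ ℚ._<_
        (cong ℚ.∣_∣ (solve 4 (λ a b c d → a :- b :+ (c :- d) := a :+ c :- (b :+ d)) refl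
          (seq x m) (seq x n) (seq y m) (seq y n)))
        (half+half ε)
        (ℚP.≤-<-trans (ℚP.∣p+q∣≤∣p∣+∣q∣ dx dy)
          (ℚP.+-mono-<
            (f m n (ℕP.m⊔n≤o⇒m≤o M N M⊔N≤m) (ℕP.m⊔n≤o⇒m≤o M N M⊔N≤n))
            (g m n (ℕP.m⊔n≤o⇒n≤o M N M⊔N≤m) (ℕP.m⊔n≤o⇒n≤o M N M⊔N≤n))))
    where open ℚSolver.+-*-Solver

_+ᴿ_ : ℝ → ℝ → ℝ
x +ᴿ y = mkℝ (λ n → seq x n ℚ.+ seq y n) (+-cauchy x y)

_-ᴿ_ : ℝ → ℝ → ℝ
x -ᴿ y = x +ᴿ -ᴿ y

eventually-bounded : ∀ x → ∃₂ λ b N → 0ℚ ℚ.< b × (∀ n → N ℕ.≤ n → ℚ.∣ seq x n ∣ ℚ.≤ b)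
eventually-bounded x =
  let (N , h) = cauchy x (ℚP.positive⁻¹ 1ℚ)
      b = 1ℚ ℚ.+ ℚ.∣ seq x N ∣
  in b , N
   , ℚP.<-≤-trans (ℚP.positive⁻¹ 1ℚ)
       (ℚP.≤-trans (ℚP.≤-reflexive (sym (ℚP.+-identityʳ 1ℚ)))
         (ℚP.+-monoʳ-≤ 1ℚ (ℚP.0≤∣p∣ (seq x N))))
   , λ n N≤n → ℚP.≤-trans
       (ℚP.≤-reflexive (cong ℚ.∣_∣
         (solve 2 (λ a c → a := a :- c :+ c) refl (seq x n) (seq x N))))
       (ℚP.≤-trans (ℚP.∣p+q∣≤∣p∣+∣q∣ (seq x n ℚ.- seq x N) (seq x N))
         (ℚP.+-monoˡ-≤ ℚ.∣ seq x N ∣ (ℚP.<⇒≤ (h n N N≤n ℕP.≤-refl))))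
  where open ℚSolver.+-*-Solver

shrink : ∀ {B ε} → 0ℚ ℚ.< B → 0ℚ ℚ.< ε → ∃[ δ ] 0ℚ ℚ.< δ × B ℚ.* δ ℚ.< ε
shrink {B} {ε} 0<B 0<ε = δ , 0<δ , subst (ℚ._< ε) (sym Bδ≡½ε) ½ε<ε
  where
  instance
    B-pos : ℚ.Positive B
    B-pos = ℚ.positive 0<B
    B-nonZero : ℚ.NonZero B
    B-nonZero = ℚP.pos⇒nonZero B
  δ = (ℚ.1/ B) ℚ.* (½ ℚ.* ε)
  0<δ : 0ℚ ℚ.< δ
  0<δ = *-pos (ℚP.positive⁻¹ (ℚ.1/ B) {{ℚP.1/pos⇒pos B}}) (half-pos 0<ε)
  Bδ≡½ε : B ℚ.* δ ≡ ½ ℚ.* ε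
  Bδ≡½ε = trans (sym (ℚP.*-assoc B (ℚ.1/ B) (½ ℚ.* ε)))
    (trans (cong (ℚ._* (½ ℚ.* ε)) (ℚP.*-inverseʳ B)) (ℚP.*-identityˡ (½ ℚ.* ε)))
  ½ε<ε : ½ ℚ.* ε ℚ.< ε
  ½ε<ε = subst₂ ℚ._<_ (ℚP.+-identityʳ (½ ℚ.* ε)) (half+half ε)
    (ℚP.+-monoʳ-< (½ ℚ.* ε) (half-pos 0<ε))

∣p*q∣≤ : ∀ p q {r δ} → ℚ.∣ p ∣ ℚ.≤ r → ℚ.∣ q ∣ ℚ.< δ → ℚ.∣ p ℚ.* q ∣ ℚ.≤ r ℚ.* δ
∣p*q∣≤ p q p≤ q< = ℚP.≤-trans (ℚP.≤-reflexive (ℚP.∣p*q∣≡∣p∣*∣q∣ p q))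
  (*-mono (ℚP.0≤∣p∣ p) (ℚP.0≤∣p∣ q) p≤ (ℚP.<⇒≤ q<))

*-close : ∀ a a' d d' {b c δ} → ℚ.∣ a ∣ ℚ.≤ b → ℚ.∣ d' ∣ ℚ.≤ c →
  ℚ.∣ a ℚ.- a' ∣ ℚ.< δ → ℚ.∣ d ℚ.- d' ∣ ℚ.< δ →
  ℚ.∣ a ℚ.* d ℚ.- a' ℚ.* d' ∣ ℚ.≤ (b ℚ.+ c) ℚ.* δ
*-close a a' d d' {b} {c} {δ} a≤b d'≤c da dd = begin
  ℚ.∣ a ℚ.* d ℚ.- a' ℚ.* d' ∣
    ≡⟨ cong ℚ.∣_∣ (solve 4 (λ a a' d d' → a :* d :- a' :* d' := a :* (d :- d') :+ d' :* (a :- a'))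
         refl a a' d d') ⟩
  ℚ.∣ a ℚ.* (d ℚ.- d') ℚ.+ d' ℚ.* (a ℚ.- a') ∣
    ≤⟨ ℚP.∣p+q∣≤∣p∣+∣q∣ (a ℚ.* (d ℚ.- d')) (d' ℚ.* (a ℚ.- a')) ⟩
  ℚ.∣ a ℚ.* (d ℚ.- d') ∣ ℚ.+ ℚ.∣ d' ℚ.* (a ℚ.- a') ∣
    ≤⟨ ℚP.+-mono-≤ (∣p*q∣≤ a (d ℚ.- d') a≤b dd) (∣p*q∣≤ d' (a ℚ.- a') d'≤c da) ⟩
  b ℚ.* δ ℚ.+ c ℚ.* δ
    ≡⟨ sym (ℚP.*-distribʳ-+ δ b c) ⟩
  (b ℚ.+ c) ℚ.* δ ∎
  where
  open ℚSolver.+-*-Solver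
  open ℚP.≤-Reasoning

abstract
  *-cauchy : ∀ x y → IsCauchy (λ n → seq x n ℚ.* seq y n)
  *-cauchy x y 0<ε =
    let (b , K , 0<b , ∣x∣≤b) = eventually-bounded x
        (c , L , 0<c , ∣y∣≤c) = eventually-bounded y
        (δ , 0<δ , small)     = shrink (ℚP.+-mono-< 0<b 0<c) 0<ε
        (X , near-x)          = cauchy x 0<δ
        (Y , near-y)          = cauchy y 0<δ
    in (K ℕ.⊔ L) ℕ.⊔ (X ℕ.⊔ Y) , λ m n h k →
      let h₁ = ℕP.m⊔n≤o⇒m≤o (K ℕ.⊔ L) (X ℕ.⊔ Y) h
          h₂ = ℕP.m⊔n≤o⇒n≤o (K ℕ.⊔ L) (X ℕ.⊔ Y) h
          k₁ = ℕP.m⊔n≤o⇒m≤o (K ℕ.⊔ L) (X ℕ.⊔ Y) k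
          k₂ = ℕP.m⊔n≤o⇒n≤o (K ℕ.⊔ L) (X ℕ.⊔ Y) k
      in ℚP.≤-<-trans
        (*-close (seq x m) (seq x n) (seq y m) (seq y n)
          (∣x∣≤b m (ℕP.m⊔n≤o⇒m≤o K L h₁))
          (∣y∣≤c n (ℕP.m⊔n≤o⇒n≤o K L k₁))
          (near-x m n (ℕP.m⊔n≤o⇒m≤o X Y h₂) (ℕP.m⊔n≤o⇒m≤o X Y k₂))
          (near-y m n (ℕP.m⊔n≤o⇒n≤o X Y h₂) (ℕP.m⊔n≤o⇒n≤o X Y k₂)))
        small

_*ᴿ_ : ℝ → ℝ → ℝ
x *ᴿ y = mkℝ (λ n → seq x n ℚ.* seq y n) (*-cauchy x y)

isqrt : ℕ → ℕ
isqrt zero = 0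
isqrt (suc n) with suc (isqrt n) ℕ.* suc (isqrt n) ℕ.≤? suc n
... | yes _ = suc (isqrt n)
... | no  _ = isqrt n

isqrt-lower : ∀ n → isqrt n ℕ.* isqrt n ℕ.≤ n
isqrt-lower zero = ℕ.z≤n
isqrt-lower (suc n) with suc (isqrt n) ℕ.* suc (isqrt n) ℕ.≤? suc n
... | yes h = h
... | no  _ = ℕP.m≤n⇒m≤1+n (isqrt-lower n)

isqrt-upper : ∀ n → n ℕ.< suc (isqrt n) ℕ.* suc (isqrt n)
isqrt-upper zero = ℕ.s≤s ℕ.z≤n
isqrt-upper (suc n) with suc (isqrt n) ℕ.* suc (isqrt n) ℕ.≤? suc n
... | yes _ = ℕP.≤-<-trans (isqrt-upper n)
                (ℕP.*-mono-< (ℕP.n<1+n (suc (isqrt n))) (ℕP.n<1+n (suc (isqrt n))))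
... | no h  = ℕP.≰⇒> h

-- For q = a / b ≥ 0, √q = √(a b k²) / (b k) with k = n + 1; taking the integer
-- square root of the numerator is off by at most 1 / (b k) ≤ 1 / (n + 1).
nonNeg-√-approx : ℕ → ℚ → ℚ
nonNeg-√-approx n q@record{} =
  + isqrt (ℤ.∣ ↥ q ∣ ℕ.* ↧ₙ q ℕ.* (suc n ℕ.* suc n)) / (↧ₙ q ℕ.* suc n)

-- Negative arguments are sent to 0, so that Cauchy sequences of possibly
-- negative rationals representing a nonnegative real are handled.
√-approx : ℕ → ℚ → ℚ
√-approx n q = nonNeg-√-approx n (q ℚ.⊔ 0ℚ)

√-approx-nonNeg : ∀ n q → 0ℚ ℚ.≤ √-approx n q
√-approx-nonNeg n q with q ℚ.⊔ 0ℚ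
... | mkℚ a d c = ℚP.nonNegative⁻¹ _
  {{ℚP.normalize-nonNeg (isqrt (ℤ.∣ a ∣ ℕ.* suc d ℕ.* (suc n ℕ.* suc n))) (suc d ℕ.* suc n)}}

nonNeg-√-lower : ∀ n q → 0ℚ ℚ.≤ q → nonNeg-√-approx n q ℚ.* nonNeg-√-approx n q ℚ.≤ q
nonNeg-√-lower n (mkℚ -[1+ a ] d c) 0≤q = ⊥-elim (absurd (ℚP.drop-*≤* 0≤q))
  where
  absurd : ¬ (+ 0 ℤ.* + suc d ℤ.≤ -[1+ a ] ℤ.* + 1)
  absurd ()
nonNeg-√-lower n q@(mkℚ (+ a) d c) 0≤q = ℚP.toℚᵘ-cancel-≤
  (ℚᵘP.≤-respˡ-≃ (ℚᵘP.≃-sym (ℚᵘP.≃-trans (ℚP.toℚᵘ-homo-* s s) (ℚᵘP.*-cong s≃ s≃)))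
    (ℚᵘ.*≤* (subst₂ ℤ._≤_
      (trans (ℤP.pos-* (r ℕ.* r) b) (cong (ℤ._* + b) (ℤP.pos-* r r)))
      (ℤP.pos-* a (D ℕ.* D))
      (ℤ.+≤+ (ℕP.≤-trans (ℕP.*-monoˡ-≤ b (isqrt-lower (a ℕ.* b ℕ.* (k ℕ.* k))))
        (ℕP.≤-reflexive (solve 3
          (λ a b k → a :* b :* (k :* k) :* b := a :* (b :* k :* (b :* k))) refl a b k)))))))
  where
  open ℕSolver.+-*-Solver
  b = suc d
  k = suc n
  D = b ℕ.* k
  r = isqrt (a ℕ.* b ℕ.* (k ℕ.* k))
  s = nonNeg-√-approx n q
  s≃ : ℚ.toℚᵘ s ℚᵘ.≃ ℚᵘ.mkℚᵘ (+ r) (ℕ.pred D)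
  s≃ = toℚᵘ-/ (+ r) (ℕ.pred D)

nonNeg-√-upper : ∀ n q → 0ℚ ℚ.≤ q → let t = nonNeg-√-approx n q ℚ.+ 1/suc n in q ℚ.≤ t ℚ.* t
nonNeg-√-upper n (mkℚ -[1+ a ] d c) 0≤q = ⊥-elim (absurd (ℚP.drop-*≤* 0≤q))
  where
  absurd : ¬ (+ 0 ℤ.* + suc d ℤ.≤ -[1+ a ] ℤ.* + 1)
  absurd ()
nonNeg-√-upper n q@(mkℚ (+ a) d c) 0≤q = ℚP.toℚᵘ-cancel-≤
  (ℚᵘP.≤-respʳ-≃ (ℚᵘP.≃-sym (ℚᵘP.≃-trans (ℚP.toℚᵘ-homo-* t t) (ℚᵘP.*-cong t≃ t≃)))
    (ℚᵘ.*≤* (subst₂ ℤ._≤_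
      (ℤP.pos-* a (E ℕ.* E))
      (trans (ℤP.pos-* (u ℕ.* u) b) (cong (ℤ._* + b) (trans (ℤP.pos-* u u) (cong₂ ℤ._*_ u≡ u≡))))
      (ℤ.+≤+ main))))
  where
  open ℕSolver.+-*-Solver
  b = suc d
  k = suc n
  D = b ℕ.* k
  E = D ℕ.* k
  M = a ℕ.* b ℕ.* (k ℕ.* k)
  r = isqrt M
  s = nonNeg-√-approx n q
  t = s ℚ.+ 1/suc n
  u = r ℕ.* k ℕ.+ 1 ℕ.* D
  u≡ : + u ≡ + r ℤ.* + k ℤ.+ + 1 ℤ.* + D
  u≡ = trans (ℤP.pos-+ (r ℕ.* k) (1 ℕ.* D)) (cong₂ ℤ._+_ (ℤP.pos-* r k) (ℤP.pos-* 1 D))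
  t≃ : ℚ.toℚᵘ t ℚᵘ.≃ ℚᵘ.mkℚᵘ (+ r) (ℕ.pred D) ℚᵘ.+ ℚᵘ.mkℚᵘ (+ 1) n
  t≃ = ℚᵘP.≃-trans (ℚP.toℚᵘ-homo-+ s (1/suc n))
    (ℚᵘP.+-cong (toℚᵘ-/ (+ r) (ℕ.pred D)) (toℚᵘ-/ (+ 1) n))
  k+rk≤u : suc r ℕ.* k ℕ.≤ u
  k+rk≤u = ℕP.≤-trans (ℕP.≤-reflexive (ℕP.+-comm k (r ℕ.* k)))
    (ℕP.+-monoʳ-≤ (r ℕ.* k) (ℕP.≤-trans (ℕP.m≤m+n k (d ℕ.* k))
      (ℕP.≤-reflexive (sym (ℕP.*-identityˡ D)))))
  main : a ℕ.* (E ℕ.* E) ℕ.≤ u ℕ.* u ℕ.* b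
  main = ℕP.≤-trans
    (ℕP.≤-reflexive (solve 3 (λ a b k → a :* (b :* k :* k :* (b :* k :* k)) :=
      a :* b :* (k :* k) :* (k :* k) :* b) refl a b k))
    (ℕP.*-monoˡ-≤ b (ℕP.≤-trans
      (ℕP.*-monoˡ-≤ (k ℕ.* k) (ℕP.<⇒≤ (isqrt-upper M)))
      (ℕP.≤-trans
        (ℕP.≤-reflexive (solve 2 (λ r k → r :* r :* (k :* k) := r :* k :* (r :* k)) refl (suc r) k))
        (ℕP.*-mono-≤ k+rk≤u k+rk≤u))))

√-approx-lower : ∀ n q → √-approx n q ℚ.* √-approx n q ℚ.≤ q ℚ.⊔ 0ℚ
√-approx-lower n q = nonNeg-√-lower n (q ℚ.⊔ 0ℚ) (ℚP.p≤q⊔p q 0ℚ)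

√-approx-upper : ∀ n q → let t = √-approx n q ℚ.+ 1/suc n in q ℚ.⊔ 0ℚ ℚ.≤ t ℚ.* t
√-approx-upper n q = nonNeg-√-upper n (q ℚ.⊔ 0ℚ) (ℚP.p≤q⊔p q 0ℚ)

√-approx-close : ∀ {m n p q δ η} → 0ℚ ℚ.< δ → ℚ.∣ p ℚ.- q ∣ ℚ.< δ ℚ.* δ → 1/suc n ℚ.< η →
  √-approx m p ℚ.< √-approx n q ℚ.+ (δ ℚ.+ η)
√-approx-close {m} {n} {p} {q} {δ} {η} 0<δ near 1/n<η = ℚP.≤-<-trans
  (square-cancel-≤ 0≤w (begin
    s ℚ.* s                          ≤⟨ √-approx-lower m p ⟩
    p ℚ.⊔ 0ℚ                         ≤⟨ ℚP.⊔-lub p≤ 0≤q+δδ ⟩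
    q ℚ.⊔ 0ℚ ℚ.+ δ ℚ.* δ             ≤⟨ ℚP.+-monoˡ-≤ (δ ℚ.* δ) (√-approx-upper n q) ⟩
    v ℚ.* v ℚ.+ δ ℚ.* δ              ≡⟨ sym (ℚP.+-identityʳ _) ⟩
    v ℚ.* v ℚ.+ δ ℚ.* δ ℚ.+ 0ℚ       ≤⟨ ℚP.+-monoʳ-≤ (v ℚ.* v ℚ.+ δ ℚ.* δ) 0≤cross ⟩
    v ℚ.* v ℚ.+ δ ℚ.* δ ℚ.+ (v ℚ.* δ ℚ.+ v ℚ.* δ)
      ≡⟨ solve 2 (λ v d → v :* v :+ d :* d :+ (v :* d :+ v :* d) := (v :+ d) :* (v :+ d)) refl v δ ⟩
    (v ℚ.+ δ) ℚ.* (v ℚ.+ δ)          ∎))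
  (subst (ℚ._< t ℚ.+ (δ ℚ.+ η))
    (solve 3 (λ t d e → t :+ (d :+ e) := t :+ e :+ d) refl t δ (1/suc n))
    (ℚP.+-monoʳ-< t (ℚP.+-monoʳ-< δ 1/n<η)))
  where
  open ℚSolver.+-*-Solver
  open ℚP.≤-Reasoning
  s = √-approx m p
  t = √-approx n q
  v = t ℚ.+ 1/suc n
  0≤v : 0ℚ ℚ.≤ v
  0≤v = ℚP.+-mono-≤ (√-approx-nonNeg n q) (ℚP.nonNegative⁻¹ (1/suc n) {{ℚP.normalize-nonNeg 1 (suc n)}})
  0≤w : 0ℚ ℚ.≤ v ℚ.+ δ
  0≤w = ℚP.+-mono-≤ 0≤v (ℚP.<⇒≤ 0<δ)
  0≤vδ : 0ℚ ℚ.≤ v ℚ.* δ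
  0≤vδ = *-mono ℚP.≤-refl ℚP.≤-refl 0≤v (ℚP.<⇒≤ 0<δ)
  0≤cross : 0ℚ ℚ.≤ v ℚ.* δ ℚ.+ v ℚ.* δ
  0≤cross = ℚP.+-mono-≤ 0≤vδ 0≤vδ
  p≤ : p ℚ.≤ q ℚ.⊔ 0ℚ ℚ.+ δ ℚ.* δ
  p≤ = ℚP.≤-trans (ℚP.<⇒≤ (∣-∣<⇒< near)) (ℚP.+-monoˡ-≤ (δ ℚ.* δ) (ℚP.p≤p⊔q q 0ℚ))
  0≤q+δδ : 0ℚ ℚ.≤ q ℚ.⊔ 0ℚ ℚ.+ δ ℚ.* δ
  0≤q+δδ = ℚP.+-mono-≤ (ℚP.p≤q⊔p q 0ℚ) (ℚP.<⇒≤ (*-pos 0<δ 0<δ))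

abstract
  √-cauchy : ∀ x → IsCauchy (λ n → √-approx n (seq x n))
  √-cauchy x {ε} 0<ε =
    let 0<δ = half-pos 0<ε
        (M , near)  = cauchy x (*-pos 0<δ 0<δ)
        (N , small) = archimedean 0<δ
        one-sided : ∀ m n → M ℕ.⊔ N ℕ.≤ m → M ℕ.⊔ N ℕ.≤ n →
                    √-approx m (seq x m) ℚ.< √-approx n (seq x n) ℚ.+ ε
        one-sided = λ m n h k → subst (λ e → √-approx m (seq x m) ℚ.< √-approx n (seq x n) ℚ.+ e)
          (half+half ε)
          (√-approx-close {m} {n} {seq x m} {seq x n} 0<δ
            (near m n (ℕP.m⊔n≤o⇒m≤o M N h) (ℕP.m⊔n≤o⇒m≤o M N k))
            (small n (ℕP.m⊔n≤o⇒n≤o M N k)))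
    in M ℕ.⊔ N , λ m n h k → <⇒∣-∣< (one-sided m n h k) (one-sided n m k h)

√_ : ℝ → ℝ
√ x = mkℝ (λ n → √-approx n (seq x n)) (√-cauchy x)

record ℂ : Set where
  constructor _+i_
  field
    re im : ℝ

open ℂ

infix 4 _+i_
infixl 6 _+ᶜ_ _-ᶜ_
infixl 7 _*ᶜ_
infixr 8 _^ᶜ_

_+ᶜ_ _-ᶜ_ _*ᶜ_ : ℂ → ℂ → ℂ
(a +i b) +ᶜ (c +i d) = (a +ᴿ c) +i (b +ᴿ d)
(a +i b) -ᶜ (c +i d) = (a -ᴿ c) +i (b -ᴿ d)
(a +i b) *ᶜ (c +i d) = (a *ᴿ c -ᴿ b *ᴿ d) +i (a *ᴿ d +ᴿ b *ᴿ c)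

ℚ→ℂ : ℚ → ℂ
ℚ→ℂ q = fromℚ q +i 0ᴿ

_^ᶜ_ : ℂ → ℕ → ℂ
z ^ᶜ zero  = ℚ→ℂ 1ℚ
z ^ᶜ suc n = z *ᶜ z ^ᶜ n

∣_∣ : ℂ → ℝ
∣ z ∣ = √ (re z *ᴿ re z +ᴿ im z *ᴿ im z)

infix 4 _⟶_

_⟶_ : (ℕ → ℂ) → ℂ → Set
f ⟶ l = ∀ (ε : ℝ) → 0ᴿ <ᴿ ε → ∃[ N ] (∀ n → N ℕ.≤ n → ∣ f n -ᶜ l ∣ <ᴿ ε)

partialSum : (ℕ → ℂ) → ℕ → ℂ
partialSum a zero    = ℚ→ℂ 0ℚ
partialSum a (suc n) = partialSum a n +ᶜ a n

HasSum : (ℕ → ℂ) → ℂ → Set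
HasSum a s = partialSum a ⟶ s

-- w = exp z, as the sum of its power series.
IsExp : ℂ → ℂ → Set
IsExp z w = HasSum (λ k → ℚ→ℂ ((+ 1 / (k !)) {{k ℕP.!≢0}}) *ᶜ z ^ᶜ k) w

record Graph : Set₁ where
  field
    Vertex     : Set
    Adj        : Vertex → Vertex → Set
    Adj-sym    : ∀ {x y} → Adj x y → Adj y x
    Adj-irrefl : ∀ {x} → ¬ Adj x x

module _ (G : Graph) where
  open Graph G

  -- Adjacency is irrelevant, so equality of arcs is equality of end points.
  record Arc : Set where
    constructor arc
    field
      origin terminus : Vertex
      .adjacent       : Adj origin terminus

open Arc public

module _ {G : Graph} where
  open Graph G

  infix 9 _⁻¹

  _⁻¹ : Arc G → Arc G
  (arc x y x~y) ⁻¹ = arc y x (Adj-sym x~y)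

  IsPath : ∀ {m} → Vec (Arc G) m → Set
  IsPath = Linked (λ e f → terminus e ≡ origin f)

  Backtrackless : ∀ {m} → Vec (Arc G) m → Set
  Backtrackless = Linked (λ e f → f ≢ e ⁻¹)

  IsCycleAt : ∀ {k} → Vertex → Vec (Arc G) (suc k) → Set
  IsCycleAt x₀ es = IsPath es × origin (head es) ≡ x₀ × terminus (last es) ≡ x₀

  Tailless : ∀ {k} → Vec (Arc G) (suc k) → Set
  Tailless es = last es ≢ head es ⁻¹

  IsReducedCycleAt : ∀ {k} → Vertex → Vec (Arc G) (suc k) → Set
  IsReducedCycleAt x₀ es = IsCycleAt x₀ es × Backtrackless es × Tailless es

HasCount : {A : Set} → (A → Set) → ℕ → Set
HasCount {A} P N = ∃[ xs ] Unique xs × (∀ (x : A) → x ∈ xs ⇔ P x) × length xs ≡ N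

-- z = ζ_G(u).  The value N k is N⁰_{k+1}, so the series starts at length 1.
IsZeta : (G : Graph) → Graph.Vertex G → ℂ → ℂ → Set
IsZeta G x₀ u z = ∃₂ λ (N : ℕ → ℕ) (s : ℂ) →
    (∀ k → HasCount {Vec (Arc G) (suc k)} (IsReducedCycleAt x₀) (N k))
  × HasSum (λ k → ℚ→ℂ (+ N k / suc k) *ᶜ u ^ᶜ suc k) s
  × IsExp s z

cycleGraph : ∀ n → 3 ℕ.≤ n → Graph
cycleGraph n 3≤n = record
  { Vertex     = Fin n
  ; Adj        = λ i j → Next i j ⊎ Next j i
  ; Adj-sym    = swap
  ; Adj-irrefl = λ { (inj₁ h) → Next-irrefl h ; (inj₂ h) → Next-irrefl h }
  }
  where
  -- j ≡ i + 1 modulo n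
  Next : Fin n → Fin n → Set
  Next i j = suc (toℕ i) ≡ toℕ j ⊎ (suc (toℕ i) ≡ n × toℕ j ≡ 0)

  Next-irrefl : ∀ {i} → ¬ Next i i
  Next-irrefl (inj₁ h) = ℕP.1+n≢n h
  Next-irrefl {i} (inj₂ (1+i≡n , i≡0)) with subst (3 ℕ.≤_) (trans (sym 1+i≡n) (cong suc i≡0)) 3≤n
  ... | ℕ.s≤s ()

integerLattice : Graph
integerLattice = record
  { Vertex     = ℤ
  ; Adj        = λ k l → l ≡ ℤ.suc k ⊎ k ≡ ℤ.suc l
  ; Adj-sym    = swap
  ; Adj-irrefl = λ { (inj₁ h) → irr h ; (inj₂ h) → irr h }
  }
  where
  irr : ∀ {k} → ¬ (k ≡ ℤ.suc k)
  irr {k} h = ℤP.i≢suc[i] h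

{-# OPTIONS --safe #-}
module Submission where

-- A reduced cycle in a 2-regular graph never turns round, so from x₀ there is at
-- most one of each length in either direction.  On ℤ none closes up, so ζ_ℤ = 1;
-- on C_n both close up exactly when n divides the length, so log ζ_{C_n}(u) is a
-- series whose terms of degree below n vanish and are otherwise at most 4 |u|^k in
-- ℓ¹ norm.  Its tail bound tends to 0 with n, and exp is continuous at 0.
--
-- A series of complex numbers with a geometric majorant converges uniformly in the
-- index m of the rational approximations, so the diagonal sequence, the m-th
-- approximation of the m-th partial sum, represents its sum.

open import Defs
import Algebra.Bundles
import Algebra.Properties.CommutativeSemiring.Exp as Exp
open import Data.Bool using (if_then_else_)
open import Data.Empty using (⊥-elim)
open import Data.Fin using (Fin; toℕ)
import Data.Fin.Properties as FinP
open import Data.Integer as ℤ using (ℤ; +_; -[1+_])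
import Data.Integer.Properties as ℤP
open import Data.List using ([]; _∷_)
open import Data.List.Membership.Propositional using (_∈_)
import Data.List.Relation.Unary.All as All
open import Data.List.Relation.Unary.AllPairs using ([]; _∷_)
open import Data.List.Relation.Unary.Any using (here; there)
open import Data.Nat as ℕ using (ℕ; zero; suc; _≤_; _!)
open import Data.Nat.Divisibility using (_∣_; _∣?_; divides; >⇒∤)
open import Data.Nat.DivMod
  using (_%_; _mod_; m<n⇒m%n≡m; m%n%n≡m%n; %-distribˡ-+; n%n≡0; %-remove-+ʳ; m≡m%n+[m/n]*n)
open import Data.Nat.GeneralisedArithmetic using (iterate)
import Data.Nat.Properties as ℕP
import Data.Nat.Solver as ℕSolver
open import Data.Product using (∃; ∃₂; ∃-syntax; _×_; _,_; proj₁; proj₂)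
open import Data.Rational as ℚ using (ℚ; mkℚ; 0ℚ; 1ℚ; ½; _/_)
import Data.Rational.Properties as ℚP
import Data.Rational.Solver as ℚSolver
import Data.Rational.Unnormalised as ℚᵘ
import Data.Rational.Unnormalised.Properties as ℚᵘP
open import Data.Sum using (_⊎_; inj₁; inj₂; [_,_]; swap)
open import Data.Vec using (Vec; []; _∷_; head; last)
open import Data.Vec.Relation.Unary.Linked using ([-]; _∷_)
open import Function using (mk⇔)
open import Relation.Binary.Definitions using (DecidableEquality)
open import Relation.Binary.PropositionalEquality
  using (_≡_; _≢_; refl; sym; trans; cong; cong₂; subst; subst₂; module ≡-Reasoning)
open import Relation.Nullary using (Dec; does; yes; no; recompute; _⊎-dec_)

open ℝ
open ℂ
open Exp (Algebra.Bundles.CommutativeRing.commutativeSemiring ℚP.+-*-commutativeRing)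
  using (_^_; ^-distrib-*)

-- Rational distances and diagonal sequences.

∣p-q∣≡∣q-p∣ : ∀ p q → ℚ.∣ p ℚ.- q ∣ ≡ ℚ.∣ q ℚ.- p ∣
∣p-q∣≡∣q-p∣ p q = trans (sym (ℚP.∣-p∣≡∣p∣ (p ℚ.- q)))
  (cong ℚ.∣_∣ (solve 2 (λ a b → :- (a :- b) := b :- a) refl p q))
  where open ℚSolver.+-*-Solver

∣-∣-triangle : ∀ p q r → ℚ.∣ p ℚ.- r ∣ ℚ.≤ ℚ.∣ p ℚ.- q ∣ ℚ.+ ℚ.∣ q ℚ.- r ∣
∣-∣-triangle p q r = subst (λ d → ℚ.∣ d ∣ ℚ.≤ ℚ.∣ p ℚ.- q ∣ ℚ.+ ℚ.∣ q ℚ.- r ∣)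
  (solve 3 (λ a b c → a :- b :+ (b :- c) := a :- c) refl p q r)
  (ℚP.∣p+q∣≤∣p∣+∣q∣ (p ℚ.- q) (q ℚ.- r))
  where open ℚSolver.+-*-Solver

p≤p+q : ∀ p {q} → 0ℚ ℚ.≤ q → p ℚ.≤ p ℚ.+ q
p≤p+q p {q} 0≤q = subst (ℚ._≤ p ℚ.+ q) (ℚP.+-identityʳ p) (ℚP.+-monoʳ-≤ p 0≤q)

p≤q+p : ∀ p {q} → 0ℚ ℚ.≤ q → p ℚ.≤ q ℚ.+ p
p≤q+p p {q} 0≤q = subst (ℚ._≤ q ℚ.+ p) (ℚP.+-identityˡ p) (ℚP.+-monoˡ-≤ p 0≤q)

-- One index `M` serves all pairs `k`, `l`. Closeness of the reals `f k` and `f l` would only give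
-- an index for each pair, too little to control a diagonal.
UniformlyCauchy : (ℕ → ℝ) → Set
UniformlyCauchy f = ∀ {ε} → 0ℚ ℚ.< ε → ∃₂ λ K M →
  ∀ k l m → K ℕ.≤ k → K ℕ.≤ l → M ℕ.≤ m → ℚ.∣ seq (f k) m ℚ.- seq (f l) m ∣ ℚ.< ε

-- The fixed member `f K` is a bridge: uniformity passes from `f m` to `f K` at index `m` and from
-- `f K` to `f n` at index `n`, and Cauchyness of `f K` passes from `m` to `n`. The errors are ε/4,
-- ε/4 and ε/2.
diagonal-cauchy : ∀ f → UniformlyCauchy f → IsCauchy (λ m → seq (f m) m)
diagonal-cauchy f f-uc {ε} 0<ε =
  let 0<δ = half-pos 0<ε
      0<η = half-pos 0<δ
      (K , M , close) = f-uc 0<η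
      (N , near) = cauchy (f K) 0<δ
  in K ℕ.⊔ (M ℕ.⊔ N) , λ m n h k →
    let h′ = ℕP.m⊔n≤o⇒n≤o K (M ℕ.⊔ N) h
        k′ = ℕP.m⊔n≤o⇒n≤o K (M ℕ.⊔ N) k
        x = seq (f m) m
        y = seq (f K) m
        z = seq (f K) n
        w = seq (f n) n
        x~y = close m K m (ℕP.m⊔n≤o⇒m≤o K (M ℕ.⊔ N) h) ℕP.≤-refl (ℕP.m⊔n≤o⇒m≤o M N h′)
        y~z = near m n (ℕP.m⊔n≤o⇒n≤o M N h′) (ℕP.m⊔n≤o⇒n≤o M N k′)
        z~w = close K n n ℕP.≤-refl (ℕP.m⊔n≤o⇒m≤o K (M ℕ.⊔ N) k) (ℕP.m⊔n≤o⇒m≤o M N k′)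
    in begin-strict
      ℚ.∣ x ℚ.- w ∣
        ≤⟨ ∣-∣-triangle x y w ⟩
      ℚ.∣ x ℚ.- y ∣ ℚ.+ ℚ.∣ y ℚ.- w ∣
        ≤⟨ ℚP.+-monoʳ-≤ ℚ.∣ x ℚ.- y ∣ (∣-∣-triangle y z w) ⟩
      ℚ.∣ x ℚ.- y ∣ ℚ.+ (ℚ.∣ y ℚ.- z ∣ ℚ.+ ℚ.∣ z ℚ.- w ∣)
        <⟨ ℚP.+-mono-< x~y (ℚP.+-mono-< y~z z~w) ⟩
      ½ ℚ.* (½ ℚ.* ε) ℚ.+ (½ ℚ.* ε ℚ.+ ½ ℚ.* (½ ℚ.* ε))
        ≡⟨ solve 1 (λ e → con ½ :* (con ½ :* e) :+ (con ½ :* e :+ con ½ :* (con ½ :* e)) := e) refl ε ⟩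
      ε ∎
  where
  open ℚSolver.+-*-Solver
  open ℚP.≤-Reasoning

-- The ℓ¹ norm of rational approximations.

-- The ℓ¹ norm of the m-th rational approximation of z.
norm : ℂ → ℕ → ℚ
norm z m = ℚ.∣ seq (re z) m ∣ ℚ.+ ℚ.∣ seq (im z) m ∣

norm-nonNeg : ∀ z m → 0ℚ ℚ.≤ norm z m
norm-nonNeg z m = ℚP.+-mono-≤ (ℚP.0≤∣p∣ (seq (re z) m)) (ℚP.0≤∣p∣ (seq (im z) m))

norm--ᶜ-sym : ∀ x y m → norm (x -ᶜ y) m ≡ norm (y -ᶜ x) m
norm--ᶜ-sym x y m = cong₂ ℚ._+_ (∣p-q∣≡∣q-p∣ (seq (re x) m) (seq (re y) m))
  (∣p-q∣≡∣q-p∣ (seq (im x) m) (seq (im y) m))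

norm-+ : ∀ x y m → norm (x +ᶜ y) m ℚ.≤ norm x m ℚ.+ norm y m
norm-+ x y m = ℚP.≤-trans
  (ℚP.+-mono-≤ (ℚP.∣p+q∣≤∣p∣+∣q∣ (seq (re x) m) (seq (re y) m))
    (ℚP.∣p+q∣≤∣p∣+∣q∣ (seq (im x) m) (seq (im y) m)))
  (ℚP.≤-reflexive (solve 4 (λ a b c d → a :+ b :+ (c :+ d) := a :+ c :+ (b :+ d)) refl
    ℚ.∣ seq (re x) m ∣ ℚ.∣ seq (re y) m ∣ ℚ.∣ seq (im x) m ∣ ℚ.∣ seq (im y) m ∣))
  where open ℚSolver.+-*-Solver

norm≤norm-ᶜ+norm : ∀ x y m → norm x m ℚ.≤ norm (x -ᶜ y) m ℚ.+ norm y m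
norm≤norm-ᶜ+norm x y m = ℚP.≤-trans
  (ℚP.≤-reflexive (cong₂ (λ p q → ℚ.∣ p ∣ ℚ.+ ℚ.∣ q ∣)
    (p≡p-q+q (seq (re x) m) (seq (re y) m)) (p≡p-q+q (seq (im x) m) (seq (im y) m))))
  (norm-+ (x -ᶜ y) y m)
  where
  open ℚSolver.+-*-Solver
  p≡p-q+q : ∀ p q → p ≡ p ℚ.- q ℚ.+ q
  p≡p-q+q = solve 2 (λ p q → p := p :- q :+ q) refl

norm-triangle : ∀ x y z m → norm (x -ᶜ z) m ℚ.≤ norm (x -ᶜ y) m ℚ.+ norm (y -ᶜ z) m
norm-triangle x y z m = ℚP.≤-trans
  (ℚP.+-mono-≤ (∣-∣-triangle (seq (re x) m) (seq (re y) m) (seq (re z) m))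
    (∣-∣-triangle (seq (im x) m) (seq (im y) m) (seq (im z) m)))
  (ℚP.≤-reflexive (solve 4 (λ a b c d → a :+ b :+ (c :+ d) := a :+ c :+ (b :+ d)) refl
    ℚ.∣ seq (re x) m ℚ.- seq (re y) m ∣ ℚ.∣ seq (re y) m ℚ.- seq (re z) m ∣
    ℚ.∣ seq (im x) m ℚ.- seq (im y) m ∣ ℚ.∣ seq (im y) m ℚ.- seq (im z) m ∣))
  where open ℚSolver.+-*-Solver

norm-* : ∀ x y m → norm (x *ᶜ y) m ℚ.≤ norm x m ℚ.* norm y m
norm-* x y m = begin
  ℚ.∣ a ℚ.* c ℚ.- b ℚ.* d ∣ ℚ.+ ℚ.∣ a ℚ.* d ℚ.+ b ℚ.* c ∣
    ≤⟨ ℚP.+-mono-≤ (ℚP.∣p-q∣≤∣p∣+∣q∣ (a ℚ.* c) (b ℚ.* d)) (ℚP.∣p+q∣≤∣p∣+∣q∣ (a ℚ.* d) (b ℚ.* c)) ⟩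
  ℚ.∣ a ℚ.* c ∣ ℚ.+ ℚ.∣ b ℚ.* d ∣ ℚ.+ (ℚ.∣ a ℚ.* d ∣ ℚ.+ ℚ.∣ b ℚ.* c ∣)
    ≡⟨ cong₂ ℚ._+_ (cong₂ ℚ._+_ (ℚP.∣p*q∣≡∣p∣*∣q∣ a c) (ℚP.∣p*q∣≡∣p∣*∣q∣ b d))
         (cong₂ ℚ._+_ (ℚP.∣p*q∣≡∣p∣*∣q∣ a d) (ℚP.∣p*q∣≡∣p∣*∣q∣ b c)) ⟩
  A ℚ.* C ℚ.+ B ℚ.* D ℚ.+ (A ℚ.* D ℚ.+ B ℚ.* C)
    ≡⟨ solve 4 (λ a b c d → a :* c :+ b :* d :+ (a :* d :+ b :* c) := (a :+ b) :* (c :+ d))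
         refl A B C D ⟩
  (A ℚ.+ B) ℚ.* (C ℚ.+ D) ∎
  where
  open ℚSolver.+-*-Solver
  open ℚP.≤-Reasoning
  a = seq (re x) m
  b = seq (im x) m
  c = seq (re y) m
  d = seq (im y) m
  A = ℚ.∣ a ∣
  B = ℚ.∣ b ∣
  C = ℚ.∣ c ∣
  D = ℚ.∣ d ∣

norm-scale : ∀ {q} → 0ℚ ℚ.≤ q → ∀ z m → norm (ℚ→ℂ q *ᶜ z) m ℚ.≤ q ℚ.* norm z m
norm-scale {q} 0≤q z m = ℚP.≤-trans (norm-* (ℚ→ℂ q) z m)
  (ℚP.≤-reflexive (cong (ℚ._* norm z m) (trans (ℚP.+-identityʳ ℚ.∣ q ∣) (ℚP.0≤p⇒∣p∣≡p 0≤q))))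

∣re∣≤norm : ∀ z m → ℚ.∣ seq (re z) m ∣ ℚ.≤ norm z m
∣re∣≤norm z m = p≤p+q _ (ℚP.0≤∣p∣ (seq (im z) m))

∣im∣≤norm : ∀ z m → ℚ.∣ seq (im z) m ∣ ℚ.≤ norm z m
∣im∣≤norm z m = p≤q+p _ (ℚP.0≤∣p∣ (seq (re z) m))

p*p≡∣p∣*∣p∣ : ∀ p → p ℚ.* p ≡ ℚ.∣ p ∣ ℚ.* ℚ.∣ p ∣
p*p≡∣p∣*∣p∣ p with ℚP.∣p∣≡p∨∣p∣≡-p p
... | inj₁ e = sym (cong₂ ℚ._*_ e e)
... | inj₂ e = trans (solve 1 (λ a → a :* a := :- a :* :- a) refl p) (sym (cong₂ ℚ._*_ e e))
  where open ℚSolver.+-*-Solver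

-- The approximate root never overshoots, so its square is at most `A² + B² ≤ (A + B)²`. The bound
-- thus holds at every index, not only in the limit.
∣∣≤norm : ∀ z m → seq ∣ z ∣ m ℚ.≤ norm z m
∣∣≤norm z m = square-cancel-≤ (norm-nonNeg z m) (ℚP.≤-trans
  (√-approx-lower m (a ℚ.* a ℚ.+ b ℚ.* b))
  (ℚP.⊔-lub
    (begin
      a ℚ.* a ℚ.+ b ℚ.* b
        ≡⟨ cong₂ ℚ._+_ (p*p≡∣p∣*∣p∣ a) (p*p≡∣p∣*∣p∣ b) ⟩
      A ℚ.* A ℚ.+ B ℚ.* B
        ≤⟨ p≤p+q _ (ℚP.+-mono-≤ 0≤AB 0≤AB) ⟩
      A ℚ.* A ℚ.+ B ℚ.* B ℚ.+ (A ℚ.* B ℚ.+ A ℚ.* B)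
        ≡⟨ solve 2 (λ a b → a :* a :+ b :* b :+ (a :* b :+ a :* b) := (a :+ b) :* (a :+ b)) refl A B ⟩
      (A ℚ.+ B) ℚ.* (A ℚ.+ B) ∎)
    (*-mono ℚP.≤-refl ℚP.≤-refl (norm-nonNeg z m) (norm-nonNeg z m))))
  where
  open ℚSolver.+-*-Solver
  open ℚP.≤-Reasoning
  a = seq (re z) m
  b = seq (im z) m
  A = ℚ.∣ a ∣
  B = ℚ.∣ b ∣
  0≤AB : 0ℚ ℚ.≤ A ℚ.* B
  0≤AB = *-mono ℚP.≤-refl ℚP.≤-refl (ℚP.0≤∣p∣ a) (ℚP.0≤∣p∣ b)

-- Reduces convergence in ℂ to rational estimates in which no square root occurs.
norm-⟶ : ∀ f l →
  (∀ {ε} → 0ℚ ℚ.< ε → ∃[ N ] (∀ n → N ℕ.≤ n → ∃[ M ] (∀ m → M ℕ.≤ m → norm (f n -ᶜ l) m ℚ.≤ ε))) →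
  f ⟶ l
norm-⟶ f l small ε (δ , 0<δ , K , δ<ε) =
  let (N , h) = small (half-pos 0<δ)
  in N , λ n N≤n →
    let (M , h′) = h n N≤n
    -- Of the gap δ below ε, one half bounds the norm and the other is the margin that `<ᴿ` demands.
    in ½ ℚ.* δ , half-pos 0<δ , M ℕ.⊔ K , λ m M⊔K≤m → ℚP.≤-<-trans
      (ℚP.≤-trans
        (ℚP.+-monoˡ-≤ (½ ℚ.* δ)
          (ℚP.≤-trans (∣∣≤norm (f n -ᶜ l) m) (h′ m (ℕP.m⊔n≤o⇒m≤o M K M⊔K≤m))))
        (ℚP.≤-reflexive (trans (half+half δ) (sym (ℚP.+-identityˡ δ)))))
      (δ<ε m (ℕP.m⊔n≤o⇒n≤o M K M⊔K≤m))

-- Series with a telescoping majorant.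

TendsTo0 : (ℕ → ℚ) → Set
TendsTo0 t = ∀ {ε} → 0ℚ ℚ.< ε → ∃[ K ] (∀ k → K ℕ.≤ k → t k ℚ.< ε)

norm-x-x≡0 : ∀ x m → norm (x -ᶜ x) m ≡ 0ℚ
norm-x-x≡0 x m = cong₂ (λ p q → ℚ.∣ p ∣ ℚ.+ ℚ.∣ q ∣) {y = 0ℚ} {v = 0ℚ}
  (ℚP.+-inverseʳ (seq (re x) m)) (ℚP.+-inverseʳ (seq (im x) m))

-- The terms are majorised by the differences of t, so that the sums telescope.
module Majorised (a : ℕ → ℂ) (t : ℕ → ℚ) (M : ℕ) (0≤t : ∀ k → 0ℚ ℚ.≤ t k)
  (a≤ : ∀ k m → M ℕ.≤ m → norm (a k) m ℚ.≤ t k ℚ.- t (suc k)) where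

  private
    telescope : ∀ d k m → M ℕ.≤ m →
      norm (partialSum a (d ℕ.+ k) -ᶜ partialSum a k) m ℚ.≤ t k ℚ.- t (d ℕ.+ k)
    telescope zero    k m M≤m = ℚP.≤-reflexive
      (trans (norm-x-x≡0 (partialSum a k) m) (sym (ℚP.+-inverseʳ (t k))))
    telescope (suc d) k m M≤m = begin
      norm (partialSum a (suc (d ℕ.+ k)) -ᶜ partialSum a k) m
        ≤⟨ norm-triangle (partialSum a (suc (d ℕ.+ k))) (partialSum a (d ℕ.+ k)) (partialSum a k) m ⟩
      norm (partialSum a (suc (d ℕ.+ k)) -ᶜ partialSum a (d ℕ.+ k)) m
        ℚ.+ norm (partialSum a (d ℕ.+ k) -ᶜ partialSum a k) m
        ≤⟨ ℚP.+-mono-≤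
             (ℚP.≤-trans (ℚP.≤-reflexive (cong₂ (λ p q → ℚ.∣ p ∣ ℚ.+ ℚ.∣ q ∣)
               (x+y-x (seq (re (partialSum a (d ℕ.+ k))) m) (seq (re (a (d ℕ.+ k))) m))
               (x+y-x (seq (im (partialSum a (d ℕ.+ k))) m) (seq (im (a (d ℕ.+ k))) m))))
               (a≤ (d ℕ.+ k) m M≤m))
             (telescope d k m M≤m) ⟩
      t (d ℕ.+ k) ℚ.- t (suc (d ℕ.+ k)) ℚ.+ (t k ℚ.- t (d ℕ.+ k))
        ≡⟨ solve 3 (λ x y z → x :- y :+ (z :- x) := z :- y) refl
             (t (d ℕ.+ k)) (t (suc (d ℕ.+ k))) (t k) ⟩
      t k ℚ.- t (suc (d ℕ.+ k)) ∎
      where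
      open ℚSolver.+-*-Solver
      open ℚP.≤-Reasoning
      x+y-x : ∀ x y → x ℚ.+ y ℚ.- x ≡ y
      x+y-x = solve 2 (λ x y → x :+ y :- x := y) refl

  -- Telescoping bounds the difference by `t k - t l`, and `t l` is nonnegative.
  tail≤ : ∀ {k l m} → k ℕ.≤ l → M ℕ.≤ m → norm (partialSum a l -ᶜ partialSum a k) m ℚ.≤ t k
  tail≤ {k} {l} {m} k≤l M≤m =
    subst (λ j → norm (partialSum a j -ᶜ partialSum a k) m ℚ.≤ t k) (ℕP.m∸n+n≡m k≤l)
      (ℚP.≤-trans (telescope (l ℕ.∸ k) k m M≤m)
        (subst (t k ℚ.- t (l ℕ.∸ k ℕ.+ k) ℚ.≤_) (ℚP.+-identityʳ (t k))
          (ℚP.+-monoʳ-≤ (t k) (ℚP.neg-antimono-≤ (0≤t (l ℕ.∸ k ℕ.+ k))))))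

  module Limit (t→0 : TendsTo0 t) where

    uniform : ∀ {ε} → 0ℚ ℚ.< ε → ∃₂ λ K N → ∀ k l m → K ℕ.≤ k → K ℕ.≤ l → N ℕ.≤ m →
      norm (partialSum a k -ᶜ partialSum a l) m ℚ.< ε
    uniform {ε} 0<ε =
      let (K , small) = t→0 0<ε
      in K , M , λ k l m K≤k K≤l M≤m → bound (small k K≤k) (small l K≤l) M≤m (ℕP.≤-total k l)
      where
      bound : ∀ {k l m} → t k ℚ.< ε → t l ℚ.< ε → M ℕ.≤ m → _ →
        norm (partialSum a k -ᶜ partialSum a l) m ℚ.< ε
      bound {k} {l} {m} tk<ε tl<ε M≤m (inj₁ k≤l) = ℚP.≤-<-trans
        (ℚP.≤-trans (ℚP.≤-reflexive (norm--ᶜ-sym (partialSum a k) (partialSum a l) m))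
          (tail≤ k≤l M≤m)) tk<ε
      bound {k} {l} {m} tk<ε tl<ε M≤m (inj₂ l≤k) = ℚP.≤-<-trans (tail≤ l≤k M≤m) tl<ε

    abstract
      re-cauchy : IsCauchy (λ m → seq (re (partialSum a m)) m)
      re-cauchy = diagonal-cauchy (λ k → re (partialSum a k)) λ 0<ε →
        let (K , N , h) = uniform 0<ε in K , N , λ k l m K≤k K≤l N≤m →
          ℚP.≤-<-trans (∣re∣≤norm (partialSum a k -ᶜ partialSum a l) m) (h k l m K≤k K≤l N≤m)

      im-cauchy : IsCauchy (λ m → seq (im (partialSum a m)) m)
      im-cauchy = diagonal-cauchy (λ k → im (partialSum a k)) λ 0<ε →
        let (K , N , h) = uniform 0<ε in K , N , λ k l m K≤k K≤l N≤m →
          ℚP.≤-<-trans (∣im∣≤norm (partialSum a k -ᶜ partialSum a l) m) (h k l m K≤k K≤l N≤m)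

    limit : ℂ
    limit = mkℝ (λ m → seq (re (partialSum a m)) m) re-cauchy
         +i mkℝ (λ m → seq (im (partialSum a m)) m) im-cauchy

    -- At index `m` the limit is by definition the `m`-th partial sum, so finite tails already give
    -- the bound.
    limit≤ : ∀ {k m} → k ℕ.≤ m → M ℕ.≤ m → norm (limit -ᶜ partialSum a k) m ℚ.≤ t k
    limit≤ k≤m M≤m = tail≤ k≤m M≤m

    hasSum : HasSum a limit
    hasSum = norm-⟶ (partialSum a) limit λ 0<ε →
      let (K , small) = t→0 0<ε
      in K , λ k K≤k → k ℕ.⊔ M , λ m h → ℚP.≤-trans
        (ℚP.≤-reflexive (norm--ᶜ-sym (partialSum a k) limit m))
        (ℚP.≤-trans (limit≤ (ℕP.m⊔n≤o⇒m≤o k M h) (ℕP.m⊔n≤o⇒n≤o k M h)) (ℚP.<⇒≤ (small k K≤k)))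

-- Natural numbers and order in ℚ.

ι : ℕ → ℚ
ι n = + n / 1

ι-suc : ∀ n → ι (suc n) ≡ 1ℚ ℚ.+ ι n
ι-suc n = ℚP.toℚᵘ-injective (ℚᵘP.≃-trans (toℚᵘ-/ (+ suc n) 0)
  (ℚᵘP.≃-trans (ℚᵘ.*≡* (cong (λ k → (+ 1 ℤ.+ k) ℤ.* + 1) (sym (ℤP.*-identityʳ (+ n)))))
    (ℚᵘP.≃-sym (ℚᵘP.≃-trans (ℚP.toℚᵘ-homo-+ 1ℚ (ι n))
      (ℚᵘP.+-congʳ (ℚ.toℚᵘ 1ℚ) (toℚᵘ-/ (+ n) 0))))))

ι-* : ∀ m n → ι (m ℕ.* n) ≡ ι m ℚ.* ι n
ι-* m n = ℚP.toℚᵘ-injective (ℚᵘP.≃-trans (toℚᵘ-/ (+ (m ℕ.* n)) 0)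
  (ℚᵘP.≃-trans (ℚᵘ.*≡* (cong (ℤ._* + 1) (ℤP.pos-* m n)))
    (ℚᵘP.≃-sym (ℚᵘP.≃-trans (ℚP.toℚᵘ-homo-* (ι m) (ι n))
      (ℚᵘP.*-cong (toℚᵘ-/ (+ m) 0) (toℚᵘ-/ (+ n) 0))))))

ι-^ : ∀ n k → ι (n ℕ.^ k) ≡ ι n ^ k
ι-^ n zero    = refl
ι-^ n (suc k) = trans (ι-* n (n ℕ.^ k)) (cong (ι n ℚ.*_) (ι-^ n k))

+/-nonNeg : ∀ n d .{{_ : ℕ.NonZero d}} → 0ℚ ℚ.≤ + n / d
+/-nonNeg n d = ℚP.nonNegative⁻¹ (+ n / d) {{ℚP.normalize-nonNeg n d}}

+/-≤-ι : ∀ {n k} d .{{_ : ℕ.NonZero d}} → n ℕ.≤ k → + n / d ℚ.≤ ι k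
+/-≤-ι {n} {k} d@(suc d-1) n≤k = ℚP.toℚᵘ-cancel-≤
  (ℚᵘP.≤-respˡ-≃ (ℚᵘP.≃-sym (toℚᵘ-/ (+ n) d-1))
    (ℚᵘP.≤-respʳ-≃ (ℚᵘP.≃-sym (toℚᵘ-/ (+ k) 0))
      (ℚᵘ.*≤* (subst₂ ℤ._≤_ (ℤP.pos-* n 1) (ℤP.pos-* k d)
        (ℤ.+≤+ (ℕP.*-mono-≤ n≤k (ℕ.s≤s ℕ.z≤n)))))))

1/d*ιd≡1 : ∀ d .{{_ : ℕ.NonZero d}} → (+ 1 / d) ℚ.* ι d ≡ 1ℚ
1/d*ιd≡1 d@(suc d-1) = ℚP.toℚᵘ-injective (ℚᵘP.≃-trans (ℚP.toℚᵘ-homo-* (+ 1 / d) (ι d))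
  (ℚᵘP.≃-trans (ℚᵘP.*-cong (toℚᵘ-/ (+ 1) d-1) (toℚᵘ-/ (+ d) 0))
    (ℚᵘ.*≡* (cong (λ k → + suc k) (trans (ℕP.*-identityʳ _)
      (trans (ℕP.+-identityʳ d-1) (sym (trans (ℕP.+-identityʳ _) (ℕP.*-identityʳ d-1)))))))))

-- The successor keeps the bound nonzero, as the majorant of the exponential series requires.
≤-ι-suc : ∀ q → ∃[ n ] q ℚ.≤ ι (suc n)
≤-ι-suc q@(mkℚ (+ a) d _) = a , ℚP.toℚᵘ-cancel-≤
  (ℚᵘP.≤-respʳ-≃ (ℚᵘP.≃-sym (toℚᵘ-/ (+ suc a) 0))
    (ℚᵘ.*≤* (subst₂ ℤ._≤_ (ℤP.pos-* a 1) (ℤP.pos-* (suc a) (suc d))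
      (ℤ.+≤+ (ℕP.*-mono-≤ (ℕP.n≤1+n a) (ℕ.s≤s ℕ.z≤n))))))
≤-ι-suc q@(mkℚ -[1+ a ] d _) = 0 , ℚP.≤-trans
  (ℚP.nonPositive⁻¹ q) (+/-nonNeg 1 1)

inverse : ∀ {e} → 0ℚ ℚ.< e → ∃[ g ] 0ℚ ℚ.< g × e ℚ.* g ≡ 1ℚ
inverse {e} 0<e = ℚ.1/ e , ℚP.positive⁻¹ (ℚ.1/ e) {{ℚP.1/pos⇒pos e}} , ℚP.*-inverseʳ e
  where
  instance
    _ : ℚ.Positive e
    _ = ℚ.positive 0<e
    _ : ℚ.NonZero e
    _ = ℚP.pos⇒nonZero e

*-nonNeg : ∀ {p q} → 0ℚ ℚ.≤ p → 0ℚ ℚ.≤ q → 0ℚ ℚ.≤ p ℚ.* q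
*-nonNeg = *-mono ℚP.≤-refl ℚP.≤-refl

square-nonNeg : ∀ p → 0ℚ ℚ.≤ p ℚ.* p
square-nonNeg p = subst (0ℚ ℚ.≤_) (sym (p*p≡∣p∣*∣p∣ p)) (*-nonNeg (ℚP.0≤∣p∣ p) (ℚP.0≤∣p∣ p))

^-nonNeg : ∀ {r} → 0ℚ ℚ.≤ r → ∀ n → 0ℚ ℚ.≤ r ^ n
^-nonNeg 0≤r zero    = +/-nonNeg 1 1
^-nonNeg 0≤r (suc n) = *-nonNeg 0≤r (^-nonNeg 0≤r n)

p≤q⇒0≤q-p : ∀ {p q} → p ℚ.≤ q → 0ℚ ℚ.≤ q ℚ.- p
p≤q⇒0≤q-p {p} {q} p≤q = subst (ℚ._≤ q ℚ.- p) (ℚP.+-inverseʳ p) (ℚP.+-monoˡ-≤ (ℚ.- p) p≤q)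

p-q≤p : ∀ p {q} → 0ℚ ℚ.≤ q → p ℚ.- q ℚ.≤ p
p-q≤p p {q} 0≤q = subst (p ℚ.- q ℚ.≤_) (ℚP.+-identityʳ p) (ℚP.+-monoʳ-≤ p (ℚP.neg-antimono-≤ 0≤q))

-- Geometric series.

module Geometric {e c : ℚ} (0<e : 0ℚ ℚ.< e) (e≤1 : e ℚ.≤ 1ℚ) (0<c : 0ℚ ℚ.< c) where
  open ℚSolver.+-*-Solver

  -- The ratio is given by its gap `e` to 1, since the tail is a power divided by `e` and
  -- Bernoulli's inequality is linear in `e`.
  r : ℚ
  r = 1ℚ ℚ.- e

  0≤r : 0ℚ ℚ.≤ r
  0≤r = p≤q⇒0≤q-p e≤1

  r≤1 : r ℚ.≤ 1ℚ
  r≤1 = p-q≤p 1ℚ (ℚP.<⇒≤ 0<e)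

  private
    g = proj₁ (inverse 0<e)
    0<g = proj₁ (proj₂ (inverse 0<e))
    eg≡1 = proj₂ (proj₂ (inverse 0<e))

  -- The sum of the terms c rʲ with k ≤ j.
  tail : ℕ → ℚ
  tail k = c ℚ.* g ℚ.* r ^ k

  tail-nonNeg : ∀ k → 0ℚ ℚ.≤ tail k
  tail-nonNeg k = *-nonNeg (ℚP.<⇒≤ (*-pos 0<c 0<g)) (^-nonNeg 0≤r k)

  tail-step : ∀ k → tail k ℚ.- tail (suc k) ≡ c ℚ.* r ^ k
  tail-step k = trans
    (solve 4 (λ c g e x → c :* g :* x :- c :* g :* ((con 1ℚ :- e) :* x) := c :* x :* (e :* g))
      refl c g e (r ^ k))
    (trans (cong (c ℚ.* r ^ k ℚ.*_) eg≡1) (ℚP.*-identityʳ (c ℚ.* r ^ k)))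

  -- Bernoulli's inequality in reciprocal form. In the induction, `(1 + (n+1)e)(1 - e)` falls short
  -- of `1 + ne` by `(n+1)e²`.
  bernoulli : ∀ n → (1ℚ ℚ.+ ι n ℚ.* e) ℚ.* r ^ n ℚ.≤ 1ℚ
  bernoulli zero    = ℚP.≤-reflexive (cong (λ p → (1ℚ ℚ.+ p) ℚ.* 1ℚ) (ℚP.*-zeroˡ e))
  bernoulli (suc n) = begin
    (1ℚ ℚ.+ ι (suc n) ℚ.* e) ℚ.* (r ℚ.* r ^ n)
      ≡⟨ cong (λ p → (1ℚ ℚ.+ p ℚ.* e) ℚ.* (r ℚ.* r ^ n)) (ι-suc n) ⟩
    (1ℚ ℚ.+ (1ℚ ℚ.+ ι n) ℚ.* e) ℚ.* (r ℚ.* r ^ n)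
      ≡⟨ solve 3 (λ i e x → (con 1ℚ :+ (con 1ℚ :+ i) :* e) :* ((con 1ℚ :- e) :* x) :=
           (con 1ℚ :+ i :* e) :* x :- (con 1ℚ :+ i) :* (e :* e) :* x) refl (ι n) e (r ^ n) ⟩
    (1ℚ ℚ.+ ι n ℚ.* e) ℚ.* r ^ n ℚ.- (1ℚ ℚ.+ ι n) ℚ.* (e ℚ.* e) ℚ.* r ^ n
      ≤⟨ p-q≤p _ (*-nonNeg (*-nonNeg (subst (0ℚ ℚ.≤_) (ι-suc n) (+/-nonNeg (suc n) 1))
           (*-nonNeg 0≤e 0≤e)) (^-nonNeg 0≤r n)) ⟩
    (1ℚ ℚ.+ ι n ℚ.* e) ℚ.* r ^ n
      ≤⟨ bernoulli n ⟩
    1ℚ ∎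
    where
    open ℚP.≤-Reasoning
    0≤e = ℚP.<⇒≤ 0<e

  -- As `e ≤ 1`, `(1 + n)e` is at most `1 + ne`, to which Bernoulli applies. The explicit rate
  -- brings in the Archimedean property.
  e*r^n≤1/suc : ∀ n → e ℚ.* r ^ n ℚ.≤ 1/suc n
  e*r^n≤1/suc n = begin
    e ℚ.* r ^ n
      ≡⟨ sym (trans (cong (ℚ._* (e ℚ.* r ^ n)) (1/d*ιd≡1 (suc n))) (ℚP.*-identityˡ _)) ⟩
    1/suc n ℚ.* ι (suc n) ℚ.* (e ℚ.* r ^ n)
      ≡⟨ cong (λ p → 1/suc n ℚ.* p ℚ.* (e ℚ.* r ^ n)) (ι-suc n) ⟩
    1/suc n ℚ.* (1ℚ ℚ.+ ι n) ℚ.* (e ℚ.* r ^ n)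
      ≡⟨ solve 4 (λ j i e x → j :* (con 1ℚ :+ i) :* (e :* x) := j :* ((e :+ i :* e) :* x)) refl
           (1/suc n) (ι n) e (r ^ n) ⟩
    1/suc n ℚ.* ((e ℚ.+ ι n ℚ.* e) ℚ.* r ^ n)
      ≤⟨ *-mono (+/-nonNeg 1 (suc n)) 0≤lhs ℚP.≤-refl (ℚP.≤-trans
           (*-mono 0≤e+ne (^-nonNeg 0≤r n) (ℚP.+-monoˡ-≤ (ι n ℚ.* e) e≤1) ℚP.≤-refl)
           (bernoulli n)) ⟩
    1/suc n ℚ.* 1ℚ
      ≡⟨ ℚP.*-identityʳ (1/suc n) ⟩
    1/suc n ∎
    where
    open ℚP.≤-Reasoning
    0≤e+ne : 0ℚ ℚ.≤ e ℚ.+ ι n ℚ.* e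
    0≤e+ne = ℚP.+-mono-≤ (ℚP.<⇒≤ 0<e) (*-nonNeg (+/-nonNeg n 1) (ℚP.<⇒≤ 0<e))
    0≤lhs : 0ℚ ℚ.≤ (e ℚ.+ ι n ℚ.* e) ℚ.* r ^ n
    0≤lhs = *-nonNeg 0≤e+ne (^-nonNeg 0≤r n)

  -- Since `e g = 1`, the tail is the constant `c g²` times `e rᵏ`, which is at most `1/(k+1)`.
  tail→0 : TendsTo0 tail
  tail→0 {ε} 0<ε =
    let 0<B = *-pos (*-pos 0<c 0<g) 0<g
        (δ , _ , Bδ<ε) , (K , 1/k<δ) = shrinking 0<B
    in K , λ k K≤k → ℚP.≤-<-trans
      (begin
        c ℚ.* g ℚ.* r ^ k
          ≡⟨ sym (trans (cong (c ℚ.* g ℚ.* r ^ k ℚ.*_) eg≡1) (ℚP.*-identityʳ _)) ⟩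
        c ℚ.* g ℚ.* r ^ k ℚ.* (e ℚ.* g)
          ≡⟨ solve 4 (λ c g e x → c :* g :* x :* (e :* g) := c :* g :* g :* (e :* x))
               refl c g e (r ^ k) ⟩
        c ℚ.* g ℚ.* g ℚ.* (e ℚ.* r ^ k)
          ≤⟨ *-mono (ℚP.<⇒≤ 0<B) (*-nonNeg (ℚP.<⇒≤ 0<e) (^-nonNeg 0≤r k)) ℚP.≤-refl
               (ℚP.≤-trans (e*r^n≤1/suc k) (ℚP.<⇒≤ (1/k<δ k K≤k))) ⟩
        c ℚ.* g ℚ.* g ℚ.* δ ∎)
      Bδ<ε
    where
    open ℚP.≤-Reasoning
    shrinking : ∀ {B} → 0ℚ ℚ.< B →
      ∃ λ ((δ , _) : ∃[ δ ] 0ℚ ℚ.< δ × B ℚ.* δ ℚ.< ε) → ∃[ K ] (∀ k → K ℕ.≤ k → 1/suc k ℚ.< δ)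
    shrinking 0<B = let s@(_ , 0<δ , _) = shrink 0<B 0<ε in s , archimedean 0<δ

-- The exponential series and its continuity at 0.

norm-^ : ∀ z {m b} → norm z m ℚ.≤ b → ∀ k → norm (z ^ᶜ k) m ℚ.≤ b ^ k
norm-^ z     z≤b zero    = ℚP.≤-refl
norm-^ z {m} z≤b (suc k) = ℚP.≤-trans (norm-* z (z ^ᶜ k) m)
  (*-mono (norm-nonNeg z m) (norm-nonNeg (z ^ᶜ k) m) z≤b (norm-^ z z≤b k))

-- Up to `k = n` the power is at most `nⁿ`. Beyond that, each further factor `n` is less than the
-- new factor of the factorial.
n^k≤n^n*k! : ∀ n .{{_ : ℕ.NonZero n}} k → n ℕ.^ k ℕ.≤ n ℕ.^ n ℕ.* k !
n^k≤n^n*k! n k with k ℕP.≤? n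
... | yes k≤n = ℕP.≤-trans (ℕP.^-monoʳ-≤ n k≤n) (ℕP.m≤m*n (n ℕ.^ n) (k !) {{k ℕP.!≢0}})
n^k≤n^n*k! n zero    | no 0≰n = ℕP.≤-trans (ℕP.m^n>0 n n) (ℕP.≤-reflexive (sym (ℕP.*-identityʳ _)))
n^k≤n^n*k! n (suc k) | no k≮n = ℕP.≤-trans
  (ℕP.*-mono-≤ (ℕP.<⇒≤ (ℕP.≰⇒> k≮n)) (n^k≤n^n*k! n k))
  (ℕP.≤-reflexive (solve 3 (λ a b c → a :* (b :* c) := b :* (a :* c)) refl (suc k) (n ℕ.^ n) (k !)))
  where
  open ℕSolver.+-*-Solver

expTerm : ℂ → ℕ → ℂ
expTerm z k = ℚ→ℂ ((+ 1 / (k !)) {{k ℕP.!≢0}}) *ᶜ z ^ᶜ k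

expTerm≤ : ∀ z {m b} → norm z m ℚ.≤ b → ∀ k →
  norm (expTerm z k) m ℚ.≤ (+ 1 / (k !)) {{k ℕP.!≢0}} ℚ.* b ^ k
expTerm≤ z {m} z≤b k = ℚP.≤-trans (norm-scale 0≤1/k! (z ^ᶜ k) m)
  (*-mono 0≤1/k! (norm-nonNeg (z ^ᶜ k) m) ℚP.≤-refl (norm-^ z z≤b k))
  where
  0≤1/k! = +/-nonNeg 1 (k !) {{k ℕP.!≢0}}

-- Geometric majorant of the exponential series, from 2 |z| ≤ n and nᵏ ≤ nⁿ k!.
expTerm≤½^ : ∀ z n .{{_ : ℕ.NonZero n}} {m} → norm z m ℚ.≤ ½ ℚ.* ι n → ∀ k →
  norm (expTerm z k) m ℚ.≤ ι (n ℕ.^ n) ℚ.* ½ ^ k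
expTerm≤½^ z n z≤½n k = ℚP.≤-trans (expTerm≤ z z≤½n k) (begin
  1/k! ℚ.* (½ ℚ.* ι n) ^ k
    ≡⟨ cong (1/k! ℚ.*_) (trans (^-distrib-* ½ (ι n) k) (cong (½ ^ k ℚ.*_) (sym (ι-^ n k)))) ⟩
  1/k! ℚ.* (½ ^ k ℚ.* ι (n ℕ.^ k))
    ≤⟨ *-mono 0≤1/k! (*-nonNeg 0≤½^k (+/-nonNeg (n ℕ.^ k) 1)) ℚP.≤-refl
         (*-mono 0≤½^k (+/-nonNeg (n ℕ.^ k) 1) ℚP.≤-refl (+/-≤-ι 1 (n^k≤n^n*k! n k))) ⟩
  1/k! ℚ.* (½ ^ k ℚ.* ι (n ℕ.^ n ℕ.* k !))
    ≡⟨ cong (λ p → 1/k! ℚ.* (½ ^ k ℚ.* p)) (ι-* (n ℕ.^ n) (k !)) ⟩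
  1/k! ℚ.* (½ ^ k ℚ.* (ι (n ℕ.^ n) ℚ.* ι (k !)))
    ≡⟨ solve 4 (λ i h c f → i :* (h :* (c :* f)) := c :* h :* (i :* f)) refl
         1/k! (½ ^ k) (ι (n ℕ.^ n)) (ι (k !)) ⟩
  ι (n ℕ.^ n) ℚ.* ½ ^ k ℚ.* (1/k! ℚ.* ι (k !))
    ≡⟨ trans (cong (ι (n ℕ.^ n) ℚ.* ½ ^ k ℚ.*_) (1/d*ιd≡1 (k !) {{k ℕP.!≢0}})) (ℚP.*-identityʳ _) ⟩
  ι (n ℕ.^ n) ℚ.* ½ ^ k ∎)
  where
  open ℚSolver.+-*-Solver
  open ℚP.≤-Reasoning
  1/k! = (+ 1 / (k !)) {{k ℕP.!≢0}}
  0≤1/k! = +/-nonNeg 1 (k !) {{k ℕP.!≢0}}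
  0≤½^k = ^-nonNeg (+/-nonNeg 1 2) k

-- Half a natural number is the form of bound for which the exponential majorant has ratio ½.
norm-eventually-bounded : ∀ z → ∃₂ λ n M → ∀ m → M ℕ.≤ m → norm z m ℚ.≤ ½ ℚ.* ι (suc n)
norm-eventually-bounded z =
  let (b , K , _ , re≤b) = eventually-bounded (re z)
      (c , L , _ , im≤c) = eventually-bounded (im z)
      (n , 2B≤n) = ≤-ι-suc ((b ℚ.+ c) ℚ.+ (b ℚ.+ c))
  in n , K ℕ.⊔ L , λ m h → ℚP.≤-trans
    (ℚP.+-mono-≤ (re≤b m (ℕP.m⊔n≤o⇒m≤o K L h)) (im≤c m (ℕP.m⊔n≤o⇒n≤o K L h)))
    (ℚP.≤-trans
      (ℚP.≤-reflexive (solve 1 (λ x → x := con ½ :* (x :+ x)) refl (b ℚ.+ c)))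
      (ℚP.*-monoˡ-≤-nonNeg ½ 2B≤n))
  where open ℚSolver.+-*-Solver

module Exponential (z : ℂ) where
  private
    n = proj₁ (norm-eventually-bounded z)
    M = proj₁ (proj₂ (norm-eventually-bounded z))
    z≤½n = proj₂ (proj₂ (norm-eventually-bounded z))

    0<n^n : 0ℚ ℚ.< ι (suc n ℕ.^ suc n)
    0<n^n = ℚP.<-≤-trans (ℚP.positive⁻¹ 1ℚ) (+/-≤-ι 1 (ℕP.m^n>0 (suc n) (suc n)))

    -- Gap ½, so that the ratio `1 - ½` computes to the ½ of `expTerm≤½^`.
    open Geometric (ℚP.positive⁻¹ ½) (+/-≤-ι {1} {1} 2 ℕP.≤-refl) 0<n^n
    open Majorised (expTerm z) tail M tail-nonNeg (λ k m M≤m →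
      ℚP.≤-trans (expTerm≤½^ z (suc n) (z≤½n m M≤m) k) (ℚP.≤-reflexive (sym (tail-step k))))
    open Limit tail→0

  abstract
    exp : ℂ
    exp = limit

    exp-isExp : IsExp z exp
    exp-isExp = hasSum

    -- A second majorant, adapted to small arguments: for `b ≤ ½` the differences of `2bᵏ` dominate
    -- `bᵏ`, so everything after the constant term is at most `2b`.
    norm-exp-1 : ∀ {b M} → b ℚ.≤ ½ → (∀ m → M ℕ.≤ m → norm z m ℚ.≤ b) →
      ∀ m → 1 ℕ.⊔ M ℕ.≤ m → norm (exp -ᶜ ℚ→ℂ 1ℚ) m ℚ.≤ b ℚ.+ b
    norm-exp-1 {b} {M} b≤½ z≤b m h =
      subst (norm (exp -ᶜ ℚ→ℂ 1ℚ) m ℚ.≤_) (cong₂ ℚ._+_ (ℚP.*-identityʳ b) (ℚP.*-identityʳ b))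
        -- At index `m` the exponential is its `m`-th partial sum, whichever majorant is used; the
        -- partial sum of length 1 computes to 1.
        (Small.tail≤ (ℕP.m⊔n≤o⇒m≤o 1 M h) (ℕP.m⊔n≤o⇒n≤o 1 M h))
      where
      open ℚSolver.+-*-Solver
      open ℚP.≤-Reasoning
      0≤b : 0ℚ ℚ.≤ b
      0≤b = ℚP.≤-trans (norm-nonNeg z M) (z≤b M ℕP.≤-refl)
      t : ℕ → ℚ
      t k = b ^ k ℚ.+ b ^ k
      1/k!≤1 : ∀ k → (+ 1 / (k !)) {{k ℕP.!≢0}} ℚ.≤ 1ℚ
      1/k!≤1 k = +/-≤-ι {1} {1} (k !) {{k ℕP.!≢0}} ℕP.≤-refl
      expTerm≤t : ∀ k m → M ℕ.≤ m → norm (expTerm z k) m ℚ.≤ t k ℚ.- t (suc k)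
      expTerm≤t k m M≤m = begin
        norm (expTerm z k) m
          ≤⟨ expTerm≤ z (z≤b m M≤m) k ⟩
        (+ 1 / (k !)) {{k ℕP.!≢0}} ℚ.* b ^ k
          ≤⟨ *-mono (+/-nonNeg 1 (k !) {{k ℕP.!≢0}}) (^-nonNeg 0≤b k) (1/k!≤1 k) ℚP.≤-refl ⟩
        1ℚ ℚ.* b ^ k
          -- The added `(1 - 2b)bᵏ`, nonnegative because `b ≤ ½`, completes `bᵏ` to `2bᵏ - 2bᵏ⁺¹`.
          ≤⟨ p≤p+q _ (*-nonNeg (*-nonNeg (+/-nonNeg 2 1) (p≤q⇒0≤q-p b≤½)) (^-nonNeg 0≤b k)) ⟩
        1ℚ ℚ.* b ^ k ℚ.+ (+ 2 / 1) ℚ.* (½ ℚ.- b) ℚ.* b ^ k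
          ≡⟨ solve 2 (λ b x → con 1ℚ :* x :+ con (+ 2 / 1) :* (con ½ :- b) :* x :=
               x :+ x :- (b :* x :+ b :* x)) refl b (b ^ k) ⟩
        t k ℚ.- t (suc k) ∎
      module Small = Majorised (expTerm z) t M
        (λ k → ℚP.+-mono-≤ (^-nonNeg 0≤b k) (^-nonNeg 0≤b k)) expTerm≤t

open Exponential using (exp; exp-isExp; norm-exp-1)

-- The Euclidean norm and the open unit disc.

sqNorm : ℂ → ℕ → ℚ
sqNorm z m = seq (re z) m ℚ.* seq (re z) m ℚ.+ seq (im z) m ℚ.* seq (im z) m

sqNorm-nonNeg : ∀ z m → 0ℚ ℚ.≤ sqNorm z m
sqNorm-nonNeg z m = ℚP.+-mono-≤ (square-nonNeg (seq (re z) m)) (square-nonNeg (seq (im z) m))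

-- Brahmagupta's identity. Powers are estimated in the Euclidean norm because the ℓ¹ norm can exceed
-- 1 inside the unit disc, where its submultiplicative bound would not decay.
sqNorm-* : ∀ x y m → sqNorm (x *ᶜ y) m ≡ sqNorm x m ℚ.* sqNorm y m
sqNorm-* x y m = solve 4
  (λ a b c d → (a :* c :- b :* d) :* (a :* c :- b :* d) :+ (a :* d :+ b :* c) :* (a :* d :+ b :* c) :=
    (a :* a :+ b :* b) :* (c :* c :+ d :* d))
  refl (seq (re x) m) (seq (im x) m) (seq (re y) m) (seq (im y) m)
  where open ℚSolver.+-*-Solver

sqNorm-^ : ∀ z {m r} → sqNorm z m ℚ.≤ r ℚ.* r → ∀ k → sqNorm (z ^ᶜ k) m ℚ.≤ r ^ k ℚ.* r ^ k
sqNorm-^ z         z≤rr zero    = ℚP.≤-refl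
sqNorm-^ z {m} {r} z≤rr (suc k) = begin
  sqNorm (z *ᶜ z ^ᶜ k) m
    ≡⟨ sqNorm-* z (z ^ᶜ k) m ⟩
  sqNorm z m ℚ.* sqNorm (z ^ᶜ k) m
    ≤⟨ *-mono (sqNorm-nonNeg z m) (sqNorm-nonNeg (z ^ᶜ k) m) z≤rr (sqNorm-^ z z≤rr k) ⟩
  r ℚ.* r ℚ.* (r ^ k ℚ.* r ^ k)
    ≡⟨ solve 2 (λ r x → r :* r :* (x :* x) := r :* x :* (r :* x)) refl r (r ^ k) ⟩
  r ℚ.* r ^ k ℚ.* (r ℚ.* r ^ k) ∎
  where
  open ℚSolver.+-*-Solver
  open ℚP.≤-Reasoning

-- Each coordinate is at most `r` in absolute value. Applied after powers are taken, the return to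
-- ℓ¹ costs a single factor 2.
norm≤2√sqNorm : ∀ z {m r} → 0ℚ ℚ.≤ r → sqNorm z m ℚ.≤ r ℚ.* r → norm z m ℚ.≤ r ℚ.+ r
norm≤2√sqNorm z {m} {r} 0≤r z≤rr = ℚP.+-mono-≤
  (square-cancel-≤ {ℚ.∣ seq (re z) m ∣} 0≤r (subst (ℚ._≤ r ℚ.* r) (p*p≡∣p∣*∣p∣ (seq (re z) m))
    (ℚP.≤-trans (p≤p+q _ (square-nonNeg (seq (im z) m))) z≤rr)))
  (square-cancel-≤ {ℚ.∣ seq (im z) m ∣} 0≤r (subst (ℚ._≤ r ℚ.* r) (p*p≡∣p∣*∣p∣ (seq (im z) m))
    (ℚP.≤-trans (p≤q+p _ (square-nonNeg (seq (re z) m))) z≤rr)))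

-- Half of the margin δ absorbs the error `1/(m+1)` of the approximate root; the other half becomes
-- the gap `e`.
∣z∣<1⇒sqNorm≤ : ∀ z → ∣ z ∣ <ᴿ 1ᴿ → ∃₂ λ e M →
  0ℚ ℚ.< e × e ℚ.≤ 1ℚ × (∀ m → M ℕ.≤ m → sqNorm z m ℚ.≤ (1ℚ ℚ.- e) ℚ.* (1ℚ ℚ.- e))
∣z∣<1⇒sqNorm≤ z (δ , 0<δ , N , ∣z∣+δ<1) =
  let (K , 1/m<e) = archimedean (half-pos 0<δ)
      √≤r : ∀ m → N ℕ.⊔ K ℕ.≤ m → s m ℚ.+ 1/suc m ℚ.≤ 1ℚ ℚ.- ½ ℚ.* δ
      √≤r = λ m h → begin
        s m ℚ.+ 1/suc m
          ≤⟨ ℚP.+-monoʳ-≤ (s m) (ℚP.<⇒≤ (1/m<e m (ℕP.m⊔n≤o⇒n≤o N K h))) ⟩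
        s m ℚ.+ ½ ℚ.* δ
          ≡⟨ solve 2 (λ x d → x :+ con ½ :* d := x :+ d :- con ½ :* d) refl (s m) δ ⟩
        s m ℚ.+ δ ℚ.- ½ ℚ.* δ
          ≤⟨ ℚP.+-monoˡ-≤ (ℚ.- (½ ℚ.* δ)) (ℚP.<⇒≤ (∣z∣+δ<1 m (ℕP.m⊔n≤o⇒m≤o N K h))) ⟩
        1ℚ ℚ.- ½ ℚ.* δ ∎
      0≤√+ : ∀ m → 0ℚ ℚ.≤ s m ℚ.+ 1/suc m
      0≤√+ = λ m → ℚP.+-mono-≤ (√-approx-nonNeg m (sqNorm z m)) (+/-nonNeg 1 (suc m))
  in ½ ℚ.* δ , N ℕ.⊔ K , half-pos 0<δ
   -- `e ≤ 1` because `1 - e` bounds a nonnegative quantity.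
   , subst₂ ℚ._≤_ (ℚP.+-identityˡ (½ ℚ.* δ))
       (solve 1 (λ e → con 1ℚ :- e :+ e := con 1ℚ) refl (½ ℚ.* δ))
       (ℚP.+-monoˡ-≤ (½ ℚ.* δ) (ℚP.≤-trans (0≤√+ (N ℕ.⊔ K)) (√≤r (N ℕ.⊔ K) ℕP.≤-refl)))
   , λ m h → ℚP.≤-trans (ℚP.p≤p⊔q (sqNorm z m) 0ℚ)
       (ℚP.≤-trans (√-approx-upper m (sqNorm z m)) (*-mono (0≤√+ m) (0≤√+ m) (√≤r m h) (√≤r m h)))
  where
  open ℚSolver.+-*-Solver
  open ℚP.≤-Reasoning
  s : ℕ → ℚ
  s = seq ∣ z ∣

-- The logarithm of the zeta function.

module ZetaSeries (u : ℂ) {e : ℚ} (0<e : 0ℚ ℚ.< e) (e≤1 : e ℚ.≤ 1ℚ) (M : ℕ)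
  (u≤ : ∀ m → M ℕ.≤ m → sqNorm u m ℚ.≤ (1ℚ ℚ.- e) ℚ.* (1ℚ ℚ.- e)) where

  -- The constant 4 is the bound 2 on the counts times the factor 2 between the norms.
  open Geometric 0<e e≤1 (ℚP.positive⁻¹ (ι 4)) public

  -- Generic in the counts, so that all cycle graphs and the lattice share one majorant.
  module _ (N : ℕ → ℕ) (N≤2 : ∀ k → N k ℕ.≤ 2) where
    private
      a : ℕ → ℂ
      a k = ℚ→ℂ (+ N k / suc k) *ᶜ u ^ᶜ suc k

      a≤ : ∀ k m → M ℕ.≤ m → norm (a k) m ℚ.≤ tail k ℚ.- tail (suc k)
      a≤ k m M≤m = begin
        norm (a k) m
          ≤⟨ norm-scale 0≤N/k (u ^ᶜ suc k) m ⟩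
        (+ N k / suc k) ℚ.* norm (u ^ᶜ suc k) m
          ≤⟨ *-mono 0≤N/k (norm-nonNeg (u ^ᶜ suc k) m) (+/-≤-ι (suc k) (N≤2 k))
               (norm≤2√sqNorm (u ^ᶜ suc k) (^-nonNeg 0≤r (suc k))
                 (sqNorm-^ u {r = r} (u≤ m M≤m) (suc k))) ⟩
        ι 2 ℚ.* (r ℚ.* r ^ k ℚ.+ r ℚ.* r ^ k)
          ≡⟨ solve 2 (λ r x → con (ι 2) :* (r :* x :+ r :* x) := con (ι 4) :* (r :* x)) refl r (r ^ k) ⟩
        ι 4 ℚ.* (r ℚ.* r ^ k)
          -- The term of index `k` carries the power `k + 1`; the spare factor `r ≤ 1` is dropped.
          ≤⟨ ℚP.*-monoˡ-≤-nonNeg (ι 4) (*-mono 0≤r (^-nonNeg 0≤r k) r≤1 ℚP.≤-refl) ⟩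
        ι 4 ℚ.* (1ℚ ℚ.* r ^ k)
          ≡⟨ cong (ι 4 ℚ.*_) (ℚP.*-identityˡ (r ^ k)) ⟩
        ι 4 ℚ.* r ^ k
          ≡⟨ sym (tail-step k) ⟩
        tail k ℚ.- tail (suc k) ∎
        where
        open ℚSolver.+-*-Solver
        open ℚP.≤-Reasoning
        0≤N/k = +/-nonNeg (N k) (suc k)

      open Majorised a tail M tail-nonNeg a≤
      open Limit tail→0

      partialSum-vanishes : ∀ K → (∀ k → k ℕ.< K → N k ≡ 0) → ∀ m → norm (partialSum a K) m ℚ.≤ 0ℚ
      partialSum-vanishes zero    N≡0 m = ℚP.≤-refl
      partialSum-vanishes (suc K) N≡0 m = ℚP.≤-trans (norm-+ (partialSum a K) (a K) m)
        (ℚP.+-mono-≤ (partialSum-vanishes K (λ k k<K → N≡0 k (ℕP.m<n⇒m<1+n k<K)) m)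
          (ℚP.≤-trans (norm-scale (+/-nonNeg (N K) (suc K)) (u ^ᶜ suc K) m)
            (ℚP.≤-reflexive (trans
              (cong (ℚ._* norm (u ^ᶜ suc K) m)
                (trans (cong (λ n → + n / suc K) (N≡0 K ℕP.≤-refl)) (ℚP.0/n≡0 (suc K))))
              (ℚP.*-zeroˡ (norm (u ^ᶜ suc K) m))))))

    abstract
      logζ : ℂ
      logζ = limit

      logζ-hasSum : HasSum (λ k → ℚ→ℂ (+ N k / suc k) *ᶜ u ^ᶜ suc k) logζ
      logζ-hasSum = hasSum

      -- With the first `K` terms zero, the limit is its own tail from `K`.
      norm-log : ∀ K → (∀ k → k ℕ.< K → N k ≡ 0) → ∀ m → K ℕ.⊔ M ℕ.≤ m → norm logζ m ℚ.≤ tail K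
      norm-log K N≡0 m h = ℚP.≤-trans (norm≤norm-ᶜ+norm logζ (partialSum a K) m)
        (subst (norm (logζ -ᶜ partialSum a K) m ℚ.+ norm (partialSum a K) m ℚ.≤_)
          (ℚP.+-identityʳ (tail K))
          (ℚP.+-mono-≤ (limit≤ (ℕP.m⊔n≤o⇒m≤o K M h) (ℕP.m⊔n≤o⇒n≤o K M h))
            (partialSum-vanishes K N≡0 m)))

    ζ : ℂ
    ζ = exp logζ

    norm-ζ-1 : ∀ K → (∀ k → k ℕ.< K → N k ≡ 0) → tail K ℚ.≤ ½ →
      ∀ m → 1 ℕ.⊔ (K ℕ.⊔ M) ℕ.≤ m → norm (ζ -ᶜ ℚ→ℂ 1ℚ) m ℚ.≤ tail K ℚ.+ tail K
    norm-ζ-1 K N≡0 t≤½ = norm-exp-1 logζ t≤½ (norm-log K N≡0)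

-- Reduced cycles in 2-regular graphs.

module Walk (G : Graph) (σ τ : Graph.Vertex G → Graph.Vertex G)
  (τσ : ∀ x → τ (σ x) ≡ x) (adj-σ : ∀ x → Graph.Adj G x (σ x))
  (neighbour : (e : Arc G) → terminus e ≡ σ (origin e) ⊎ terminus e ≡ τ (origin e))
  (σσx≢x : ∀ x → σ (σ x) ≢ x) where

  open Graph G

  walk : Vertex → ∀ k → Vec (Arc G) (suc k)
  walk x zero    = arc x (σ x) (adj-σ x) ∷ []
  walk x (suc k) = arc x (σ x) (adj-σ x) ∷ walk (σ x) k

  origin-head-walk : ∀ x k → origin (head (walk x k)) ≡ x
  origin-head-walk x zero    = refl
  origin-head-walk x (suc k) = refl

  terminus-head-walk : ∀ x k → terminus (head (walk x k)) ≡ σ x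
  terminus-head-walk x zero    = refl
  terminus-head-walk x (suc k) = refl

  -- `last` is stuck on a tail that is not visibly a cons, as `walk x k` is for variable `k`.
  last-∷ : ∀ {A : Set} {k} (x : A) (xs : Vec A (suc k)) → last (x ∷ xs) ≡ last xs
  last-∷ x (y ∷ ys) = refl

  terminus-last-walk : ∀ x k → terminus (last (walk x k)) ≡ iterate σ x (suc k)
  terminus-last-walk x zero    = refl
  terminus-last-walk x (suc k) = trans (cong terminus (last-∷ (arc x (σ x) (adj-σ x)) (walk (σ x) k)))
    (terminus-last-walk (σ x) k)

  σ-last-walk : ∀ x k → terminus (last (walk x k)) ≡ σ (origin (last (walk x k)))
  σ-last-walk x zero    = refl
  σ-last-walk x (suc k) = trans (cong terminus (last-∷ (arc x (σ x) (adj-σ x)) (walk (σ x) k)))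
    (trans (σ-last-walk (σ x) k)
      (cong (λ e → σ (origin e)) (sym (last-∷ (arc x (σ x) (adj-σ x)) (walk (σ x) k)))))

  walk-isPath : ∀ x k → IsPath (walk x k)
  walk-isPath x zero    = [-]
  walk-isPath x (suc k) = sym (origin-head-walk (σ x) k) ∷ walk-isPath (σ x) k

  walk-backtrackless : ∀ x k → Backtrackless (walk x k)
  walk-backtrackless x zero    = [-]
  walk-backtrackless x (suc k) =
    (λ e → σσx≢x x (trans (sym (terminus-head-walk (σ x) k)) (cong terminus e)))
    ∷ walk-backtrackless (σ x) k

  -- If the last arc reversed the first, it would start at `σ x` and end at `σ (σ x)`; closing up
  -- would make this `x`.
  walk-tailless : ∀ x k → iterate σ x (suc k) ≡ x → Tailless (walk x k)
  walk-tailless x k closed e = σσx≢x x (begin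
    σ (σ x)                          ≡⟨ cong σ (sym (terminus-head-walk x k)) ⟩
    σ (terminus (head (walk x k)))   ≡⟨ cong (λ f → σ (origin f)) (sym e) ⟩
    σ (origin (last (walk x k)))     ≡⟨ sym (σ-last-walk x k) ⟩
    terminus (last (walk x k))       ≡⟨ terminus-last-walk x k ⟩
    iterate σ x (suc k)              ≡⟨ closed ⟩
    x                                ∎)
    where open ≡-Reasoning

  walk-reduced : ∀ x k → iterate σ x (suc k) ≡ x → IsReducedCycleAt x (walk x k)
  walk-reduced x k closed =
    (walk-isPath x k , origin-head-walk x k , trans (terminus-last-walk x k) closed)
    , walk-backtrackless x k , walk-tailless x k closed

  arc-≡ : (e f : Arc G) → origin e ≡ origin f → terminus e ≡ terminus f → e ≡ f
  arc-≡ (arc x y _) (arc .x .y _) refl refl = refl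

  -- A neighbour of σ x is σ (σ x) or τ (σ x) = x, and the latter would be a backtracking.
  path-is-walk : ∀ {k} (es : Vec (Arc G) (suc k)) → IsPath es → Backtrackless es →
    terminus (head es) ≡ σ (origin (head es)) → es ≡ walk (origin (head es)) k
  path-is-walk (e ∷ []) _ _ e≡σ = cong (_∷ []) (arc-≡ e _ refl e≡σ)
  path-is-walk {suc k} (e ∷ es@(f ∷ _)) (e~f ∷ path) (f≢e⁻¹ ∷ reduced) e≡σ with neighbour f
  ... | inj₁ f≡σ = cong₂ _∷_ (arc-≡ e _ refl e≡σ)
    (trans (path-is-walk es path reduced f≡σ) (cong (λ x → walk x k) (trans (sym e~f) e≡σ)))
  ... | inj₂ f≡τ = ⊥-elim (f≢e⁻¹ (arc-≡ f (e ⁻¹) (sym e~f)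
    (trans f≡τ (trans (cong τ (trans (sym e~f) e≡σ)) (τσ _)))))

  reduced-is-walk : ∀ {x k} {es : Vec (Arc G) (suc k)} → IsReducedCycleAt x es →
    terminus (head es) ≡ σ (origin (head es)) → es ≡ walk x k × iterate σ x (suc k) ≡ x
  reduced-is-walk {x} {k} {es} ((path , refl , end) , reduced , _) e≡σ =
    es≡ , trans (sym (terminus-last-walk x k)) (trans (cong (λ es → terminus (last es)) (sym es≡)) end)
    where es≡ = path-is-walk es path reduced e≡σ

-- A 2-regular graph in which σ and τ = σ⁻¹ are the two directions of travel.
module TwoDirections (G : Graph) (_≟_ : DecidableEquality (Graph.Vertex G))
  (σ τ : Graph.Vertex G → Graph.Vertex G) (τσ : ∀ x → τ (σ x) ≡ x) (στ : ∀ x → σ (τ x) ≡ x)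
  (adj-σ : ∀ x → Graph.Adj G x (σ x)) (adj-τ : ∀ x → Graph.Adj G x (τ x))
  (adj⇒ : ∀ {x y} → Graph.Adj G x y → y ≡ σ x ⊎ y ≡ τ x)
  (σσx≢x : ∀ x → σ (σ x) ≢ x) where

  open Graph G

  -- The adjacency stored in an arc is irrelevant; decidability recovers the direction.
  neighbour : (e : Arc G) → terminus e ≡ σ (origin e) ⊎ terminus e ≡ τ (origin e)
  neighbour (arc x y x~y) = recompute (y ≟ σ x ⊎-dec y ≟ τ x) (adj⇒ x~y)

  ττx≢x : ∀ x → τ (τ x) ≢ x
  ττx≢x x e = σσx≢x x (trans (cong (λ y → σ (σ y)) (sym e)) (trans (cong σ (στ (τ x))) (στ x)))

  iterate-suc : ∀ (f : Vertex → Vertex) x k → iterate f x (suc k) ≡ f (iterate f x k)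
  iterate-suc f x zero    = refl
  iterate-suc f x (suc k) = iterate-suc f (f x) k

  -- Walking back undoes walking forth, so the two directions close up at the same lengths.
  iterate-inverse : ∀ (f g : Vertex → Vertex) → (∀ x → g (f x) ≡ x) → ∀ x k →
    iterate g (iterate f x k) k ≡ x
  iterate-inverse f g gf x zero    = refl
  iterate-inverse f g gf x (suc k) = trans
    (cong (λ y → iterate g (g y) k) (iterate-suc f x k))
    (trans (cong (λ y → iterate g y k) (gf (iterate f x k))) (iterate-inverse f g gf x k))

  module Forward  = Walk G σ τ τσ adj-σ neighbour σσx≢x
  module Backward = Walk G τ σ στ adj-τ (λ e → swap (neighbour e)) ττx≢x

  count-closed : ∀ x k → iterate σ x (suc k) ≡ x → HasCount (IsReducedCycleAt {G} {k} x) 2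
  count-closed x k σ-closed = forward ∷ backward ∷ []
    , (forward≢backward All.∷ All.[]) ∷ All.[] ∷ []
    , (λ es → mk⇔
        (λ { (here refl)         → Forward.walk-reduced x k σ-closed
           ; (there (here refl)) → Backward.walk-reduced x k τ-closed })
        -- The direction of the first arc decides which of the two walks a reduced cycle is.
        (λ reduced → [_,_] {C = λ _ → es ∈ forward ∷ backward ∷ []}
          (λ e≡σ → here (proj₁ (Forward.reduced-is-walk reduced e≡σ)))
          (λ e≡τ → there (here (proj₁ (Backward.reduced-is-walk reduced e≡τ))))
          (neighbour (head es))))
    , refl
    where
    forward  = Forward.walk x k
    backward = Backward.walk x k
    τ-closed : iterate τ x (suc k) ≡ x
    τ-closed = trans (cong (λ y → iterate τ y (suc k)) (sym σ-closed))
      (iterate-inverse σ τ τσ x (suc k))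
    -- Equal walks would have `σ x = τ x`, hence `σ (σ x) = x`.
    forward≢backward : forward ≢ backward
    forward≢backward e = σσx≢x x (trans
      (cong σ (trans (sym (Forward.terminus-head-walk x k))
        (trans (cong (λ es → terminus (head es)) e) (Backward.terminus-head-walk x k))))
      (στ x))

  count-open : ∀ x k → iterate σ x (suc k) ≢ x → HasCount (IsReducedCycleAt {G} {k} x) 0
  count-open x k ¬closed = [] , []
    , (λ es → mk⇔ (λ ()) (λ reduced → ⊥-elim
        ([ (λ e≡σ → ¬closed (proj₂ (Forward.reduced-is-walk reduced e≡σ)))
         , (λ e≡τ → ¬closed (σ-closed (proj₂ (Backward.reduced-is-walk reduced e≡τ)))) ]
         (neighbour (head es)))))
    , refl
    where
    σ-closed : iterate τ x (suc k) ≡ x → iterate σ x (suc k) ≡ x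
    σ-closed τ-closed = trans (cong (λ y → iterate σ y (suc k)) (sym τ-closed))
      (iterate-inverse τ σ στ x (suc k))

-- Counts on the integer lattice.

module Lattice where

  adj⇒ : ∀ {x y} → Graph.Adj integerLattice x y → y ≡ ℤ.suc x ⊎ y ≡ ℤ.pred x
  adj⇒ (inj₁ y≡)   = inj₁ y≡
  adj⇒ (inj₂ refl) = inj₂ (sym (ℤP.pred-suc _))

  suc≤iterate : ∀ k x → ℤ.suc x ℤ.≤ iterate ℤ.suc x (suc k)
  suc≤iterate zero    x = ℤP.≤-refl
  suc≤iterate (suc k) x = ℤP.≤-trans (ℤP.i≤suc[i] (ℤ.suc x)) (suc≤iterate k (ℤ.suc x))

  iterate-suc≢ : ∀ k x → iterate ℤ.suc x (suc k) ≢ x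
  iterate-suc≢ k x closed = ℤP.i≢suc[i] (sym (ℤP.≤-antisym
    (ℤP.≤-trans (suc≤iterate k x) (ℤP.≤-reflexive closed)) (ℤP.i≤suc[i] x)))

  -- Index 1 in `iterate-suc≢` means two steps, which gives `σ (σ x) ≢ x`.
  open TwoDirections integerLattice ℤP._≟_ ℤ.suc ℤ.pred ℤP.pred-suc ℤP.suc-pred
    (λ _ → inj₁ refl) (λ x → inj₂ (sym (ℤP.suc-pred x))) adj⇒ (iterate-suc≢ 1)

  count : ∀ x k → HasCount (IsReducedCycleAt {integerLattice} {k} x) 0
  count x k = count-open x k (iterate-suc≢ k x)

-- Rotations and counts on cycle graphs.

module Rotation (n : ℕ) .{{_ : ℕ.NonZero n}} where

  rotate : ℕ → Fin n → Fin n
  rotate a x = (toℕ x ℕ.+ a) mod n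

  toℕ-rotate : ∀ a x → toℕ (rotate a x) ≡ (toℕ x ℕ.+ a) % n
  toℕ-rotate a x = FinP.toℕ-fromℕ< _

  toℕ-% : ∀ (x : Fin n) → toℕ x % n ≡ toℕ x
  toℕ-% x = m<n⇒m%n≡m (FinP.toℕ<n x)

  rotate-+ : ∀ a b x → rotate b (rotate a x) ≡ rotate (a ℕ.+ b) x
  rotate-+ a b x = FinP.toℕ-injective (begin
    toℕ (rotate b (rotate a x))             ≡⟨ toℕ-rotate b (rotate a x) ⟩
    (toℕ (rotate a x) ℕ.+ b) % n            ≡⟨ cong (λ y → (y ℕ.+ b) % n) (toℕ-rotate a x) ⟩
    ((toℕ x ℕ.+ a) % n ℕ.+ b) % n           ≡⟨ %-distribˡ-+ ((toℕ x ℕ.+ a) % n) b n ⟩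
    ((toℕ x ℕ.+ a) % n % n ℕ.+ b % n) % n   ≡⟨ cong (λ y → (y ℕ.+ b % n) % n) (m%n%n≡m%n (toℕ x ℕ.+ a) n) ⟩
    ((toℕ x ℕ.+ a) % n ℕ.+ b % n) % n       ≡⟨ sym (%-distribˡ-+ (toℕ x ℕ.+ a) b n) ⟩
    (toℕ x ℕ.+ a ℕ.+ b) % n                 ≡⟨ cong (_% n) (ℕP.+-assoc (toℕ x) a b) ⟩
    (toℕ x ℕ.+ (a ℕ.+ b)) % n               ≡⟨ sym (toℕ-rotate (a ℕ.+ b) x) ⟩
    toℕ (rotate (a ℕ.+ b) x)                ∎)
    where open ≡-Reasoning

  rotate-closed : ∀ {a} → n ∣ a → ∀ x → rotate a x ≡ x
  rotate-closed {a} n∣a x = FinP.toℕ-injective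
    (trans (toℕ-rotate a x) (trans (%-remove-+ʳ (toℕ x) n∣a) (toℕ-% x)))

  -- Division of `toℕ x + a` by `n` leaves remainder `toℕ x`; cancelling it shows `a` to be the
  -- quotient times `n`.
  rotate-closed⇒∣ : ∀ {a x} → rotate a x ≡ x → n ∣ a
  rotate-closed⇒∣ {a} {x} e = divides ((toℕ x ℕ.+ a) ℕ./ n) (ℕP.+-cancelˡ-≡ (toℕ x) _ _
    (trans (m≡m%n+[m/n]*n (toℕ x ℕ.+ a) n)
      (cong (ℕ._+ ((toℕ x ℕ.+ a) ℕ./ n) ℕ.* n) (trans (sym (toℕ-rotate a x)) (cong toℕ e)))))

  iterate-rotate : ∀ k x → iterate (rotate 1) x (suc k) ≡ rotate (suc k) x
  iterate-rotate zero    x = refl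
  iterate-rotate (suc k) x = trans (iterate-rotate k (rotate 1 x)) (rotate-+ 1 (suc k) x)

module Cycle (n-1 : ℕ) (3≤n : 3 ℕ.≤ suc n-1) where
  private
    n = suc n-1
    G = cycleGraph n 3≤n
  open Graph G
  open Rotation n public

  σ τ : Fin n → Fin n
  σ = rotate 1
  -- Rotation by -1 modulo `n`.
  τ = rotate n-1

  τσ : ∀ x → τ (σ x) ≡ x
  τσ x = trans (rotate-+ 1 n-1 x) (rotate-closed (divides 1 (sym (ℕP.*-identityˡ n))) x)

  στ : ∀ x → σ (τ x) ≡ x
  στ x = trans (rotate-+ n-1 1 x)
    (rotate-closed (divides 1 (trans (ℕP.+-comm n-1 1) (sym (ℕP.*-identityˡ n)))) x)

  -- Repeats the relation local to `cycleGraph`, with which it agrees definitionally.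
  Next : Fin n → Fin n → Set
  Next i j = suc (toℕ i) ≡ toℕ j ⊎ (suc (toℕ i) ≡ n × toℕ j ≡ 0)

  Next⇒σ : ∀ {i j} → Next i j → j ≡ σ i
  Next⇒σ {i} {j} next = FinP.toℕ-injective
    (trans (toℕ-j next) (trans (cong (_% n) (ℕP.+-comm 1 (toℕ i))) (sym (toℕ-rotate 1 i))))
    where
    toℕ-j : Next i j → toℕ j ≡ suc (toℕ i) % n
    toℕ-j (inj₁ e)       = trans (sym (toℕ-% j)) (cong (_% n) (sym e))
    toℕ-j (inj₂ (e , z)) = trans z (sym (trans (cong (_% n) e) (n%n≡0 n)))

  Next-σ : ∀ i → Next i (σ i)
  Next-σ i with suc (toℕ i) ℕP.≟ n
  ... | yes e = inj₂ (e , trans (toℕ-rotate 1 i)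
    (trans (cong (_% n) (trans (ℕP.+-comm (toℕ i) 1) e)) (n%n≡0 n)))
  ... | no ¬e = inj₁ (sym (trans (toℕ-rotate 1 i)
    (trans (cong (_% n) (ℕP.+-comm (toℕ i) 1)) (m<n⇒m%n≡m (ℕP.≤∧≢⇒< (FinP.toℕ<n i) ¬e)))))

  -- A fixed point of the double rotation would force `n` to divide 2.
  σσx≢x : ∀ x → σ (σ x) ≢ x
  σσx≢x x e = >⇒∤ 3≤n (rotate-closed⇒∣ (trans (sym (rotate-+ 1 1 x)) e))

  adj⇒ : ∀ {i j} → Adj i j → j ≡ σ i ⊎ j ≡ τ i
  adj⇒ (inj₁ next) = inj₁ (Next⇒σ next)
  adj⇒ (inj₂ next) = inj₂ (sym (trans (cong τ (Next⇒σ next)) (τσ _)))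

  open TwoDirections G FinP._≟_ σ τ τσ στ
    (λ x → inj₁ (Next-σ x)) (λ x → inj₂ (subst (Next (τ x)) (στ x) (Next-σ (τ x))))
    adj⇒ σσx≢x public using (count-closed; count-open)

-- Defined for every `n`, so that the zeta values form a sequence over ℕ; those for `n < 3` are
-- placeholders.
cycleCount : ℕ → ℕ → ℕ
cycleCount n k = if does (n ∣? suc k) then 2 else 0

cycleCount≤2 : ∀ n k → cycleCount n k ℕ.≤ 2
cycleCount≤2 n k with n ∣? suc k
... | yes _ = ℕP.≤-refl
... | no  _ = ℕ.z≤n

cycleCount≡0 : ∀ {n k} → suc k ℕ.< n → cycleCount n k ≡ 0
cycleCount≡0 {n} {k} k<n with n ∣? suc k
... | yes n∣k = ⊥-elim (>⇒∤ k<n n∣k)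
... | no  _ = refl

cycleGraph-count : ∀ n 3≤n x k → HasCount (IsReducedCycleAt {cycleGraph n 3≤n} {k} x) (cycleCount n k)
cycleGraph-count n@(suc n-1) 3≤n x k = count (n ∣? suc k)
  where
  open Cycle n-1 3≤n
  -- The decision is generalised so that matching on it lets the `if` compute.
  count : (n∣k? : Dec (n ∣ suc k)) →
    HasCount (IsReducedCycleAt {cycleGraph n 3≤n} {k} x) (if does n∣k? then 2 else 0)
  count (yes n∣k) = count-closed x k (trans (iterate-rotate k x) (rotate-closed n∣k x))
  count (no  n∤k) = count-open x k λ e → n∤k (rotate-closed⇒∣ (trans (sym (iterate-rotate k x)) e))

-- Convergence of the zeta values.

module ZetaLimit (u : ℂ) {e : ℚ} (0<e : 0ℚ ℚ.< e) (e≤1 : e ℚ.≤ 1ℚ) (M : ℕ)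
  (u≤ : ∀ m → M ℕ.≤ m → sqNorm u m ℚ.≤ (1ℚ ℚ.- e) ℚ.* (1ℚ ℚ.- e)) where

  open ZetaSeries u 0<e e≤1 M u≤

  ζC : ℕ → ℂ
  ζC n = ζ (cycleCount n) (cycleCount≤2 n)

  ζZ : ℂ
  ζZ = ζ (λ _ → 0) (λ _ → ℕ.z≤n)

  -- Both zeta values lie within `2 tail k` of 1, so they differ by at most `4 tail k`.
  close : ∀ n k {ε} → k ℕ.< n → tail k ℚ.< ½ → tail k ℚ.< ½ ℚ.* (½ ℚ.* ε) →
    ∀ m → 1 ℕ.⊔ (k ℕ.⊔ M) ≤ m → norm (ζC n -ᶜ ζZ) m ℚ.≤ ε
  close n k {ε} k<n t<½ t<¼ε m h = begin
    norm (ζC n -ᶜ ζZ) m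
      ≤⟨ norm-triangle (ζC n) (ℚ→ℂ 1ℚ) ζZ m ⟩
    norm (ζC n -ᶜ ℚ→ℂ 1ℚ) m ℚ.+ norm (ℚ→ℂ 1ℚ -ᶜ ζZ) m
      ≡⟨ cong (norm (ζC n -ᶜ ℚ→ℂ 1ℚ) m ℚ.+_) (norm--ᶜ-sym (ℚ→ℂ 1ℚ) ζZ m) ⟩
    norm (ζC n -ᶜ ℚ→ℂ 1ℚ) m ℚ.+ norm (ζZ -ᶜ ℚ→ℂ 1ℚ) m
      ≤⟨ ℚP.+-mono-≤
           (norm-ζ-1 (cycleCount n) (cycleCount≤2 n) k
             -- The term of index `j` counts cycles of length `j + 1`, at most `k` and so below `n`.
             (λ j j<k → cycleCount≡0 (ℕP.≤-<-trans j<k k<n)) (ℚP.<⇒≤ t<½) m h)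
           (norm-ζ-1 (λ _ → 0) (λ _ → ℕ.z≤n) k (λ _ _ → refl) (ℚP.<⇒≤ t<½) m h) ⟩
    tail k ℚ.+ tail k ℚ.+ (tail k ℚ.+ tail k)
      ≤⟨ ℚP.+-mono-≤ 2t≤ 2t≤ ⟩
    ½ ℚ.* ε ℚ.+ ½ ℚ.* ε
      ≡⟨ half+half ε ⟩
    ε ∎
    where
    open ℚP.≤-Reasoning
    2t≤ : tail k ℚ.+ tail k ℚ.≤ ½ ℚ.* ε
    2t≤ = ℚP.≤-trans (ℚP.<⇒≤ (ℚP.+-mono-< t<¼ε t<¼ε)) (ℚP.≤-reflexive (half+half (½ ℚ.* ε)))

  ζC⟶ζZ : ζC ⟶ ζZ
  ζC⟶ζZ = norm-⟶ ζC ζZ λ 0<ε →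
    let (K , tail<½) = tail→0 (ℚP.positive⁻¹ ½)
        (L , tail<¼ε) = tail→0 (half-pos (half-pos 0<ε))
        k = K ℕ.⊔ L
    in suc k , λ n k<n → 1 ℕ.⊔ (k ℕ.⊔ M) , λ m h →
      close n k k<n (tail<½ k (ℕP.m≤m⊔n K L)) (tail<¼ε k (ℕP.m≤n⊔m K L)) m h

  ζC-isZeta : ∀ n 3≤n x₀ → IsZeta (cycleGraph n 3≤n) x₀ u (ζC n)
  ζC-isZeta n 3≤n x₀ = cycleCount n , logζ (cycleCount n) (cycleCount≤2 n)
    , cycleGraph-count n 3≤n x₀ , logζ-hasSum (cycleCount n) (cycleCount≤2 n)
    , exp-isExp (logζ (cycleCount n) (cycleCount≤2 n))

  ζZ-isZeta : ∀ x₀ → IsZeta integerLattice x₀ u ζZ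
  ζZ-isZeta x₀ = (λ _ → 0) , logζ (λ _ → 0) (λ _ → ℕ.z≤n)
    , Lattice.count x₀ , logζ-hasSum (λ _ → 0) (λ _ → ℕ.z≤n)
    , exp-isExp (logζ (λ _ → 0) (λ _ → ℕ.z≤n))

theorem4 : (u : ℂ) → ∣ u ∣ <ᴿ 1ᴿ →
    ∃₂ λ (ζC : ℕ → ℂ) (ζZ : ℂ) →
    ((n : ℕ) (3≤n : 3 ≤ n) (x₀ : Fin n) → IsZeta (cycleGraph n 3≤n) x₀ u (ζC n))
    × ((x₀ : ℤ) → IsZeta integerLattice x₀ u ζZ)
    × (ζC ⟶ ζZ)
theorem4 u ∣u∣<1 =
  let (_ , M , 0<e , e≤1 , u≤) = ∣z∣<1⇒sqNorm≤ u ∣u∣<1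
      open ZetaLimit u 0<e e≤1 M u≤
  in ζC , ζZ , ζC-isZeta , ζZ-isZeta , ζC⟶ζZ
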